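{- Let $p$ be a prime number, $G$ a transitive group of degree $n\in p\mathbb{Z}\setminus p^{2}\mathbb{Z}$, and $H$ a corresponding subgroup of $G$. Assume that a $p$-Sylow subgroup $S_{p}$ of $G$ is normal and that $S_{p}\cong (C_{p})^{m}$ for some $m\neq 2$. Then $\operatorname{Sha}_{\mathcal{D}}^{2}(G,J_{G/H})[p^{\infty}]=0$ for every admissible set $\mathcal{D}$ of subgroups of $G$.
   Context: A transitive group of degree $n$ is a subgroup of $\mathfrak{S}_n$ acting transitively on $\{1,\dots,n\}$; a corresponding subgroup is a point stabilizer. $J_{G/H}$ is the cokernel of $\mathbb{Z}\to\operatorname{Ind}_H^G\mathbb{Z}=\mathrm{Hom}_{\mathbb{Z}[H]}(\mathbb{Z}[G],\mathbb{Z})$, $1\mapsto$ constant function $1$. $\operatorname{Sha}^2_{\mathcal{D}}(G,M):=\ker\big(H^2(G,M)\to\bigoplus_{D\in\mathcal{D}}H^2(D,M)\big)$. A finite set of subgroups is admissible if it contains all cyclic subgroups and is stable under conjugation. $A[p^\infty]$ is the $p$-primary torsion part. -}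

module Defs where

open import Level using (0ℓ)
open import Data.Nat as ℕ using (ℕ; zero; suc; NonZero)
open import Data.Nat.Divisibility using (_∣_)
open import Data.Nat.DivMod using (_mod_)
open import Data.Nat.Primality using (Prime; prime⇒nonZero)
open import Data.Integer as ℤ using (ℤ)
open import Data.Fin using (Fin; toℕ)
open import Data.Vec using (Vec; lookup; tabulate; zipWith)
open import Data.List using (List; length)
open import Data.List.Membership.Propositional using (_∈_)
open import Data.List.Relation.Unary.Any using (Any)
open import Data.List.Relation.Unary.Unique.Propositional using (Unique)
open import Data.Product using (Σ; ∃; ∃-syntax; _×_; _,_)
open import Relation.Binary.PropositionalEquality using (_≡_)
open import Relation.Nullary using (¬_)
open import Function using (id; _⇔_)

-- Permutations of {0,…,n-1}: σ is stored as the vector (σ 0, …, σ (n-1)).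

Perm : ℕ → Set
Perm n = Vec (Fin n) n

-- σ is a bijection (injective self-map of a finite set)
IsPerm : ∀ {n} → Perm n → Set
IsPerm σ = ∀ i j → lookup σ i ≡ lookup σ j → i ≡ j

_·ₚ_ : ∀ {n} → Perm n → Fin n → Fin n
σ ·ₚ i = lookup σ i

_*_ : ∀ {n} → Perm n → Perm n → Perm n
σ * τ = tabulate (λ i → lookup σ (lookup τ i))

idP : ∀ {n} → Perm n
idP = tabulate id

_^ₚ_ : ∀ {n} → Perm n → ℕ → Perm n
g ^ₚ zero  = idP
g ^ₚ suc k = g * (g ^ₚ k)

record Subgroup (n : ℕ) : Set where
  field
    elems     : List (Perm n)
    unique    : Unique elems
    perms     : ∀ {x} → x ∈ elems → IsPerm x
    has-id    : idP ∈ elems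
    mul-closed : ∀ {x y} → x ∈ elems → y ∈ elems → (x * y) ∈ elems
    inv-closed : ∀ {x} → x ∈ elems → ∃[ y ] (y ∈ elems × x * y ≡ idP)
open Subgroup public

_∈ˢ_ : ∀ {n} → Perm n → Subgroup n → Set
x ∈ˢ K = x ∈ elems K

order : ∀ {n} → Subgroup n → ℕ
order K = length (elems K)

_≤ˢ_ : ∀ {n} → Subgroup n → Subgroup n → Set
K ≤ˢ L = ∀ {x} → x ∈ˢ K → x ∈ˢ L

IsTransitive : ∀ {n} → Subgroup n → Set
IsTransitive {n} G = ∀ (i j : Fin n) → ∃[ g ] (g ∈ˢ G × g ·ₚ i ≡ j)

IsPointStabilizer : ∀ {n} → Subgroup n → Subgroup n → Fin n → Set
IsPointStabilizer G H i₀ = ∀ x → (x ∈ˢ H) ⇔ (x ∈ˢ G × x ·ₚ i₀ ≡ i₀)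

IsSylow : ∀ {n} → ℕ → Subgroup n → Subgroup n → Set
IsSylow p G S = S ≤ˢ G × ∃[ v ] ∃[ r ]
  (order S ≡ p ℕ.^ v × order G ≡ order S ℕ.* r × ¬ (p ∣ r))

IsNormal : ∀ {n} → Subgroup n → Subgroup n → Set
IsNormal G S = ∀ {g s} → g ∈ˢ G → s ∈ˢ S → ∃[ s' ] (s' ∈ˢ S × g * s ≡ s' * g)

module _ (p : ℕ) .{{_ : NonZero p}} where
  _+ᶜ_ : ∀ {m} → Vec (Fin p) m → Vec (Fin p) m → Vec (Fin p) m
  u +ᶜ v = zipWith (λ a b → (toℕ a ℕ.+ toℕ b) mod p) u v

IsoToCpPower : ∀ {n} (p : ℕ) → Prime p → ℕ → Subgroup n → Set
IsoToCpPower {n} p pr m S =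
  let instance _ = prime⇒nonZero pr in
  Σ (Vec (Fin p) m → Perm n) λ ι →
      (∀ u → ι u ∈ˢ S)
    × (∀ {s} → s ∈ˢ S → ∃[ u ] (ι u ≡ s))
    × (∀ u v → ι u ≡ ι v → u ≡ v)
    × (∀ u v → ι (_+ᶜ_ p u v) ≡ ι u * ι v)

SameElems : ∀ {n} → Subgroup n → Subgroup n → Set
SameElems K L = ∀ x → (x ∈ˢ K) ⇔ (x ∈ˢ L)

IsCyclicGenBy : ∀ {n} → Subgroup n → Perm n → Set
IsCyclicGenBy D g = ∀ x → (x ∈ˢ D) ⇔ (∃[ k ] (x ≡ g ^ₚ k))

IsConjugateBy : ∀ {n} → Perm n → Subgroup n → Subgroup n → Set
IsConjugateBy g K L = ∀ x → (x ∈ˢ L) ⇔ (∃[ k ] (k ∈ˢ K × x * g ≡ g * k))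

IsAdmissible : ∀ {n} → Subgroup n → List (Subgroup n) → Set
IsAdmissible G 𝒟 =
    (∀ {D} → D ∈ 𝒟 → D ≤ˢ G)
  × (∀ {g} → g ∈ˢ G → Any (λ D → IsCyclicGenBy D g) 𝒟)
  × (∀ {g D} → g ∈ˢ G → D ∈ 𝒟 → Any (IsConjugateBy g D) 𝒟)

-- The modules Ind_H^G ℤ and J_{G/H}, and H² with these coefficients.
--
-- Ind_H^G ℤ = Hom_{ℤ[H]}(ℤ[G], ℤ) is represented by functions
-- x : Perm n → ℤ (only values on G matter) with x(h y) = x(y) for h ∈ H,
-- with G acting by (g·x)(y) = x(y g).
-- J_{G/H} = Ind_H^G ℤ / ℤ·1 : representatives are elements of Ind, and
-- two are equal in J iff their difference is a constant function on G.

Cochain : ℕ → Set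
Cochain n = Perm n → ℤ

IsInd : ∀ {n} → Subgroup n → Subgroup n → Cochain n → Set
IsInd G H x = ∀ {h y} → h ∈ˢ H → y ∈ˢ G → x (h * y) ≡ x y

_≈J[_]_ : ∀ {n} → Cochain n → Subgroup n → Cochain n → Set
x ≈J[ G ] y = ∃[ c ] (∀ {z} → z ∈ˢ G → x z ≡ y z ℤ.+ c)

act : ∀ {n} → Perm n → Cochain n → Cochain n
act g x y = x (y * g)

_⊕_ : ∀ {n} → Cochain n → Cochain n → Cochain n
(x ⊕ y) z = x z ℤ.+ y z

_⊖_ : ∀ {n} → Cochain n → Cochain n → Cochain n
(x ⊖ y) z = x z ℤ.- y z

zeroJ : ∀ {n} → Cochain n
zeroJ _ = ℤ.0ℤ

Cochain2 : ℕ → Set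
Cochain2 n = Perm n → Perm n → Cochain n

Is2Cocycle : ∀ {n} → Subgroup n → Subgroup n → Cochain2 n → Set
Is2Cocycle G H f =
    (∀ {a b} → a ∈ˢ G → b ∈ˢ G → IsInd G H (f a b))
  × (∀ {a b c} → a ∈ˢ G → b ∈ˢ G → c ∈ˢ G →
       (((act a (f b c) ⊖ f (a * b) c) ⊕ f a (b * c)) ⊖ f a b) ≈J[ G ] zeroJ)

IsCoboundaryOn : ∀ {n} → Subgroup n → Subgroup n → Subgroup n → Cochain2 n → Set
IsCoboundaryOn {n} G H K f =
  Σ (Perm n → Cochain n) λ φ →
      (∀ {a} → a ∈ˢ K → IsInd G H (φ a))
    × (∀ {a b} → a ∈ˢ K → b ∈ˢ K →
         f a b ≈J[ G ] ((act a (φ b) ⊖ φ (a * b)) ⊕ φ a))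

scale2 : ∀ {n} → ℕ → Cochain2 n → Cochain2 n
scale2 k f a b z = ℤ.+ k ℤ.* f a b z

{-# OPTIONS --safe #-}

-- Evaluating cochains at the points of Fin n turns J into functions on points
-- modulo constants. Averaging f over G gives V with dV = |G| f, a crossed
-- homomorphism modulo |G| and constants, and it suffices to split V on S modulo |G|:
-- summing over S\G then kills the prime-to-p multiple [G : S] f, and f is p-power torsion.
--
-- Since p² ∤ n and S is normal, S-orbits have at most p points, so the powers of an
-- element moving i are transitive on the S-orbit of i. The constants in V define a
-- central extension of S, which splits canonically over each point stabilizer S_i;
-- vanishing of f on cyclic subgroups makes these splittings agree on S_i ∩ S_j.
-- If m ≥ 3, three stabilizers in general position glue to a splitting over S which
-- extends all the others, and its values define the function w with V = dw modulo
-- constants. If m ≤ 1, S is itself cyclic.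

module Submission where

open import Defs
open import Data.Nat as ℕ using (ℕ; zero; suc; _^_)
import Data.Nat.Properties as ℕₚ
open import Data.Nat.Divisibility using (_∣_; _∣?_; divides; ∣-trans; ∣1⇒≡1; m∣m*n; *-monoˡ-∣)
open import Data.Nat.DivMod using (_mod_; _%_; m<n⇒m%n≡m; m%n<n; m%n%n≡m%n; %-distribˡ-+; m*n%n≡0)
open import Data.Nat.Primality using (Prime; prime⇒nonZero; prime⇒nonTrivial; prime⇒irreducible)
open import Data.Nat.Coprimality using (Coprime; coprime-divisor; prime⇒coprime; coprime-Bézout)
open import Data.Nat.GCD using (module Bézout)
open import Data.Integer as ℤ using (ℤ; 0ℤ; -_; _+_; _-_) renaming (_*_ to _·_)
import Data.Integer.Properties as ℤₚ
open import Data.Integer.Divisibility.Signed using (∣m∣n⇒∣m+n; ∣m∣n⇒∣m-n; ∣m⇒∣-m) renaming (_∣_ to _∣ᶻ_; divides to dividesᶻ)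
open import Data.Integer.Tactic.RingSolver using (solve-∀)
open import Data.Fin using (Fin; toℕ) renaming (zero to fzero; suc to fsuc)
import Data.Fin.Properties as Finₚ
open import Data.Vec as Vec using (Vec; []; _∷_; lookup; replicate)
open import Data.Vec.Properties using (lookup∘tabulate; tabulate∘lookup; tabulate-cong; ≡-dec; lookup-zipWith; lookup-replicate; map-const)
open import Data.List using (List; []; _∷_; _++_; length; map; filter; allFin; upTo; cartesianProduct)
open import Data.List.Properties using (length-map; length-++; length-tabulate; length-upTo)
open import Data.List.Membership.Propositional using (_∈_; find; lose)
open import Data.List.Membership.Propositional.Properties
open import Data.List.Membership.Propositional.Properties.WithK using (unique∧set⇒bag)
open import Data.List.Relation.Binary.BagAndSetEquality using (∼bag⇒↭)
open import Data.List.Relation.Binary.Permutation.Propositional as ↭ using (_↭_; prep; swap)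
open import Data.List.Relation.Binary.Permutation.Propositional.Properties using (↭-length; ∈-resp-↭; shift)
open import Data.List.Relation.Unary.All as All using (All; []; _∷_)
import Data.List.Relation.Unary.All.Properties as Allₚ
open import Data.List.Relation.Unary.AllPairs using ([]; _∷_)
open import Data.List.Relation.Unary.Any as Any using (Any; here; there)
open import Data.List.Relation.Unary.Unique.Propositional using (Unique)
import Data.List.Relation.Unary.Unique.Propositional.Properties as Uniqueₚ
open import Data.Product using (∃-syntax; _×_; _,_; proj₁; proj₂; uncurry)
open import Data.Sum using (inj₁; inj₂)
open import Data.Empty using (⊥-elim)
open import Function using (_∘_; id; mk⇔; Equivalence)
open import Relation.Binary.Definitions using (tri<; tri≈; tri>)
open import Relation.Binary.PropositionalEquality
open import Relation.Nullary using (¬_; Dec; yes; no)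
open import Relation.Nullary.Decidable using (¬?; decidable-stable; map′)

-- Finite lists without repetition

-- `V` encodes f through the connecting map for multiplication by |G| on the torsion-free module J:
-- once V is split modulo |G|, division by |G| makes f a coboundary. The converse is weaker. If f =
-- dφ on K, then V - |G| φ is an honest crossed homomorphism from K to J, whose class in H¹(K, J)
-- may be nonzero but is killed by |K|. Hence the local condition at a cyclic group generated by a
-- is used only to compare V a at the fixed points of a, and a cyclic S needs V and the modulus
-- rescaled by |S|. The extension consists of pairs (a, u), where u differs from V a by a constant
-- modulo |G|, with product (a, u)(b, v) = (ab, i ↦ u (b i) + v i). Over the stabilizer of i the
-- splitting selects the u with u i = 0. A splitting over S forces lifts to commute, which is clear
-- only for elements with a common fixed point. If S is the product of the stabilizers of i₁ and i₂,
-- an element fixing both points has a lift commuting with everything. In rank two, distinct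
-- stabilizers of index p meet trivially and provide no such element except the identity; a third
-- point makes room for it.

unique⇒↭ : {A : Set} {xs ys : List A} → Unique xs → Unique ys →
  (∀ {x} → x ∈ xs → x ∈ ys) → (∀ {x} → x ∈ ys → x ∈ xs) → xs ↭ ys
unique⇒↭ ux uy f g = ∼bag⇒↭ (unique∧set⇒bag ux uy (mk⇔ f g))

unique-⊆⇒length≤ : {A : Set} {xs : List A} → Unique xs → (ys : List A) →
  (∀ {x} → x ∈ xs → x ∈ ys) → length xs ℕ.≤ length ys
unique-⊆⇒length≤ [] ys xs⊆ys = ℕ.z≤n
unique-⊆⇒length≤ {xs = x ∷ xs} (x∉xs ∷ uxs) ys xs⊆ys
  with zs₁ , zs₂ , refl ← ∈-∃++ (xs⊆ys (here refl)) =
  subst (suc (length xs) ℕ.≤_) (sym (↭-length (shift x zs₁ zs₂)))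
    (ℕ.s≤s (unique-⊆⇒length≤ uxs (zs₁ ++ zs₂) below))
  where
  below : ∀ {y} → y ∈ xs → y ∈ zs₁ ++ zs₂
  below y∈xs with ∈-resp-↭ (shift x zs₁ zs₂) (xs⊆ys (there y∈xs))
  ... | here y≡x = ⊥-elim (All.lookup x∉xs y∈xs (sym y≡x))
  ... | there y∈ = y∈

map-unique : {A B : Set} (f : A → B) {xs : List A} →
  (∀ {x y} → x ∈ xs → y ∈ xs → f x ≡ f y → x ≡ y) → Unique xs → Unique (map f xs)
map-unique f inj [] = []
map-unique f inj (x∉xs ∷ uxs) =
  Allₚ.map⁺ (All.tabulate λ y∈xs fx≡fy → All.lookup x∉xs y∈xs (inj (here refl) (there y∈xs) fx≡fy))
  ∷ map-unique f (λ x∈ y∈ → inj (there x∈) (there y∈)) uxs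

length-cartesianProduct : {A B : Set} (xs : List A) (ys : List B) →
  length (cartesianProduct xs ys) ≡ length xs ℕ.* length ys
length-cartesianProduct [] ys = refl
length-cartesianProduct (x ∷ xs) ys =
  trans (length-++ (map (x ,_) ys))
    (cong₂ ℕ._+_ (length-map (x ,_) ys) (length-cartesianProduct xs ys))

-- Common source of three counts: Lagrange's theorem for S in G, the orbit-stabilizer formula, and
-- the division of all points into translates of one orbit.
length-product : {A B C : Set} {xs : List A} {ys : List B} {zs : List C}
  (f : A → B → C) → Unique xs → Unique ys → Unique zs →
  (∀ {x y} → x ∈ xs → y ∈ ys → f x y ∈ zs) →
  (∀ {z} → z ∈ zs → ∃[ x ] ∃[ y ] (x ∈ xs × y ∈ ys × z ≡ f x y)) →
  (∀ {x y x′ y′} → x ∈ xs → y ∈ ys → x′ ∈ xs → y′ ∈ ys →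
     f x y ≡ f x′ y′ → x ≡ x′ × y ≡ y′) →
  length xs ℕ.* length ys ≡ length zs
length-product {xs = xs} {ys} {zs} f ux uy uz into onto inj = begin
  length xs ℕ.* length ys                 ≡⟨ length-cartesianProduct xs ys ⟨
  length (cartesianProduct xs ys)         ≡⟨ length-map (uncurry f) (cartesianProduct xs ys) ⟨
  length (map (uncurry f) (cartesianProduct xs ys))
    ≡⟨ ↭-length (unique⇒↭ (map-unique _ inj′ (Uniqueₚ.cartesianProduct⁺ ux uy)) uz into′ onto′) ⟩
  length zs ∎
  where
  open ≡-Reasoning
  inj′ : ∀ {u v} → u ∈ cartesianProduct xs ys → v ∈ cartesianProduct xs ys →
    uncurry f u ≡ uncurry f v → u ≡ v
  inj′ {x , y} {x′ , y′} u∈ v∈ eq =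
    let (a , b) = ∈-cartesianProduct⁻ xs ys u∈
        (c , d) = ∈-cartesianProduct⁻ xs ys v∈
        (e , e′) = inj a b c d eq
    in cong₂ _,_ e e′
  into′ : ∀ {z} → z ∈ map (uncurry f) (cartesianProduct xs ys) → z ∈ zs
  into′ z∈ with (x , y) , u∈ , refl ← ∈-map⁻ (uncurry f) z∈ =
    let (a , b) = ∈-cartesianProduct⁻ xs ys u∈ in into a b
  onto′ : ∀ {z} → z ∈ zs → z ∈ map (uncurry f) (cartesianProduct xs ys)
  onto′ z∈ with x , y , x∈ , y∈ , refl ← onto z∈ =
    ∈-map⁺ (uncurry f) (∈-cartesianProduct⁺ x∈ y∈)

-- Transversals of a relation on a list

record IsTransversal {A : Set} (_~_ : A → A → Set) (xs T : List A) : Set where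
  field
    T⊆         : ∀ {t} → t ∈ T → t ∈ xs
    T-distinct : Unique T
    T-apart    : ∀ {s t} → s ∈ T → t ∈ T → s ~ t → s ≡ t
    T-covers   : ∀ {x} → x ∈ xs → ∃[ t ] (t ∈ T × t ~ x)

-- Greedy choice: an element joins `T` only if nothing already chosen is related to it.
transversal : {A : Set} (_~_ : A → A → Set) → (∀ x y → Dec (x ~ y)) →
  (∀ {x y} → x ~ y → y ~ x) → (xs : List A) → (∀ {x} → x ∈ xs → x ~ x) →
  ∃[ T ] IsTransversal _~_ xs T
transversal _~_ _~?_ ~sym [] ~refl = [] , record
  { T⊆ = λ () ; T-distinct = [] ; T-apart = λ () ; T-covers = λ () }
transversal _~_ _~?_ ~sym (x ∷ xs) ~refl
  with T , tT ← transversal _~_ _~?_ ~sym xs (~refl ∘ there)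
  with Any.any? (_~? x) T
... | yes some = T , record
  { T⊆ = there ∘ T⊆ ; T-distinct = T-distinct ; T-apart = T-apart ; T-covers = covers }
  where
  open IsTransversal tT
  covers : ∀ {y} → y ∈ x ∷ xs → ∃[ t ] (t ∈ T × t ~ y)
  covers (here refl) = find some
  covers (there y∈) = T-covers y∈
... | no none = x ∷ T , record
  { T⊆ = λ { (here refl) → here refl ; (there t∈) → there (T⊆ t∈) }
  ; T-distinct = All.tabulate (λ { t∈ refl → none (lose t∈ (~refl (here refl))) }) ∷ T-distinct
  ; T-apart = apart
  ; T-covers = covers }
  where
  open IsTransversal tT
  apart : ∀ {s t} → s ∈ x ∷ T → t ∈ x ∷ T → s ~ t → s ≡ t
  apart (here refl) (here refl) s~t = refl
  apart (here refl) (there t∈) s~t = ⊥-elim (none (lose t∈ (~sym s~t)))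
  apart (there s∈) (here refl) s~t = ⊥-elim (none (lose s∈ s~t))
  apart (there s∈) (there t∈) s~t = T-apart s∈ t∈ s~t
  covers : ∀ {y} → y ∈ x ∷ xs → ∃[ t ] (t ∈ x ∷ T × t ~ y)
  covers (here refl) = x , here refl , ~refl (here refl)
  covers (there y∈) = let (t , t∈ , t~y) = T-covers y∈ in t , there t∈ , t~y

-- Finite sums

∑ : {A : Set} → List A → (A → ℤ) → ℤ
∑ [] f = 0ℤ
∑ (x ∷ xs) f = f x + ∑ xs f

∑-↭ : {A : Set} (f : A → ℤ) {xs ys : List A} → xs ↭ ys → ∑ xs f ≡ ∑ ys f
∑-↭ f ↭.refl = refl
∑-↭ f (prep x p) = cong (f x +_) (∑-↭ f p)
∑-↭ f (swap x y p) = trans (lemma (f x) (f y) _) (cong (λ s → f y + (f x + s)) (∑-↭ f p))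
  where
  lemma : ∀ a b c → a + (b + c) ≡ b + (a + c)
  lemma = solve-∀
∑-↭ f (↭.trans p q) = trans (∑-↭ f p) (∑-↭ f q)

∑-map : {A B : Set} (g : A → B) (f : B → ℤ) (xs : List A) → ∑ (map g xs) f ≡ ∑ xs (f ∘ g)
∑-map g f [] = refl
∑-map g f (x ∷ xs) = cong (f (g x) +_) (∑-map g f xs)

∑-cong : {A : Set} {f g : A → ℤ} (xs : List A) →
  (∀ {x} → x ∈ xs → f x ≡ g x) → ∑ xs f ≡ ∑ xs g
∑-cong [] eq = refl
∑-cong (x ∷ xs) eq = cong₂ _+_ (eq (here refl)) (∑-cong xs (eq ∘ there))

∑-distrib-+ : {A : Set} (f g : A → ℤ) (xs : List A) →
  ∑ xs (λ x → f x + g x) ≡ ∑ xs f + ∑ xs g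
∑-distrib-+ f g [] = refl
∑-distrib-+ f g (x ∷ xs) = trans (cong (f x + g x +_) (∑-distrib-+ f g xs)) (lemma (f x) (g x) (∑ xs f) (∑ xs g))
  where
  lemma : ∀ a b c d → a + b + (c + d) ≡ a + c + (b + d)
  lemma = solve-∀

∑-distrib-- : {A : Set} (f g : A → ℤ) (xs : List A) →
  ∑ xs (λ x → f x - g x) ≡ ∑ xs f - ∑ xs g
∑-distrib-- f g [] = refl
∑-distrib-- f g (x ∷ xs) = trans (cong (f x - g x +_) (∑-distrib-- f g xs)) (lemma (f x) (g x) (∑ xs f) (∑ xs g))
  where
  lemma : ∀ a b c d → a - b + (c - d) ≡ a + c - (b + d)
  lemma = solve-∀

∑-const : {A : Set} (c : ℤ) (xs : List A) → ∑ xs (λ _ → c) ≡ ℤ.+ length xs · c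
∑-const c [] = refl
∑-const c (x ∷ xs) = trans (cong (c +_) (∑-const c xs)) (lemma c (ℤ.+ length xs))
  where
  lemma : ∀ c l → c + l · c ≡ (ℤ.1ℤ + l) · c
  lemma = solve-∀

-- Permutations

module _ {n : ℕ} where

  _≟ₚ_ : (a b : Perm n) → Dec (a ≡ b)
  _≟ₚ_ = ≡-dec Finₚ._≟_

  *-act : (a b : Perm n) (i : Fin n) → (a * b) ·ₚ i ≡ a ·ₚ (b ·ₚ i)
  *-act a b i = lookup∘tabulate _ i

  idP-act : (i : Fin n) → idP ·ₚ i ≡ i
  idP-act i = lookup∘tabulate id i

  perm-ext : {a b : Perm n} → (∀ i → a ·ₚ i ≡ b ·ₚ i) → a ≡ b
  perm-ext {a} {b} eq = trans (sym (tabulate∘lookup a)) (trans (tabulate-cong eq) (tabulate∘lookup b))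

  *-assoc : (a b c : Perm n) → (a * b) * c ≡ a * (b * c)
  *-assoc a b c = perm-ext λ i → begin
    ((a * b) * c) ·ₚ i      ≡⟨ *-act (a * b) c i ⟩
    (a * b) ·ₚ (c ·ₚ i)     ≡⟨ *-act a b _ ⟩
    a ·ₚ (b ·ₚ (c ·ₚ i))    ≡⟨ cong (a ·ₚ_) (*-act b c i) ⟨
    a ·ₚ ((b * c) ·ₚ i)     ≡⟨ *-act a (b * c) i ⟨
    (a * (b * c)) ·ₚ i      ∎
    where open ≡-Reasoning

  *-identityˡ : (a : Perm n) → idP * a ≡ a
  *-identityˡ a = perm-ext λ i → trans (*-act idP a i) (idP-act _)

  *-identityʳ : (a : Perm n) → a * idP ≡ a
  *-identityʳ a = perm-ext λ i → trans (*-act a idP i) (cong (a ·ₚ_) (idP-act i))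

  ^ₚ-+ : (a : Perm n) (k l : ℕ) → a ^ₚ (k ℕ.+ l) ≡ (a ^ₚ k) * (a ^ₚ l)
  ^ₚ-+ a zero l = sym (*-identityˡ _)
  ^ₚ-+ a (suc k) l = trans (cong (a *_) (^ₚ-+ a k l)) (sym (*-assoc a (a ^ₚ k) (a ^ₚ l)))

  ^ₚ-fix : (a : Perm n) {i : Fin n} → a ·ₚ i ≡ i → (k : ℕ) → (a ^ₚ k) ·ₚ i ≡ i
  ^ₚ-fix a {i} fix zero = idP-act i
  ^ₚ-fix a {i} fix (suc k) = trans (*-act a (a ^ₚ k) i) (trans (cong (a ·ₚ_) (^ₚ-fix a fix k)) fix)

  *-fix : (a b : Perm n) {i : Fin n} → a ·ₚ i ≡ i → b ·ₚ i ≡ i → (a * b) ·ₚ i ≡ i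
  *-fix a b {i} fa fb = trans (*-act a b i) (trans (cong (a ·ₚ_) fb) fa)

  ^ₚ-* : (a : Perm n) (k l : ℕ) → a ^ₚ (k ℕ.* l) ≡ (a ^ₚ l) ^ₚ k
  ^ₚ-* a zero l = refl
  ^ₚ-* a (suc k) l = trans (^ₚ-+ a l (k ℕ.* l)) (cong ((a ^ₚ l) *_) (^ₚ-* a k l))

  idP-^ₚ : (k : ℕ) → idP {n} ^ₚ k ≡ idP
  idP-^ₚ zero = refl
  idP-^ₚ (suc k) = trans (*-identityˡ _) (idP-^ₚ k)

module SubgroupProperties {n : ℕ} (K : Subgroup n) where

  ^ₚ-closed : {a : Perm n} → a ∈ˢ K → (k : ℕ) → (a ^ₚ k) ∈ˢ K
  ^ₚ-closed a∈ zero = has-id K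
  ^ₚ-closed a∈ (suc k) = mul-closed K a∈ (^ₚ-closed a∈ k)

  inverse : {a : Perm n} → a ∈ˢ K → ∃[ b ] (b ∈ˢ K × a * b ≡ idP × b * a ≡ idP)
  inverse {a} a∈ with b , b∈ , ab≡1 ← inv-closed K a∈ with c , c∈ , bc≡1 ← inv-closed K b∈ =
    b , b∈ , ab≡1 , trans (cong (b *_) a≡c) bc≡1
    where
    open ≡-Reasoning
    a≡c : a ≡ c
    a≡c = begin
      a            ≡⟨ *-identityʳ a ⟨
      a * idP      ≡⟨ cong (a *_) bc≡1 ⟨
      a * (b * c)  ≡⟨ *-assoc a b c ⟨
      (a * b) * c  ≡⟨ cong (_* c) ab≡1 ⟩
      idP * c      ≡⟨ *-identityˡ c ⟩
      c            ∎

  -- Chosen inverse, with the junk value idP outside K.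
  inv : Perm n → Perm n
  inv a with Any.any? (a ≟ₚ_) (elems K)
  ... | yes a∈ = proj₁ (inverse a∈)
  ... | no _ = idP

  inv-spec : {a : Perm n} → a ∈ˢ K → inv a ∈ˢ K × a * inv a ≡ idP × inv a * a ≡ idP
  inv-spec {a} a∈ with Any.any? (a ≟ₚ_) (elems K)
  ... | yes a∈′ = proj₂ (inverse a∈′)
  ... | no a∉ = ⊥-elim (a∉ a∈)

  module _ {a : Perm n} (a∈ : a ∈ˢ K) where

    inv∈ : inv a ∈ˢ K
    inv∈ = proj₁ (inv-spec a∈)

    *-inverseʳ : a * inv a ≡ idP
    *-inverseʳ = proj₁ (proj₂ (inv-spec a∈))

    *-inverseˡ : inv a * a ≡ idP
    *-inverseˡ = proj₂ (proj₂ (inv-spec a∈))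

    act-inv : (i : Fin n) → a ·ₚ (inv a ·ₚ i) ≡ i
    act-inv i = trans (sym (*-act a (inv a) i)) (trans (cong (_·ₚ i) *-inverseʳ) (idP-act i))

    inv-act : (i : Fin n) → inv a ·ₚ (a ·ₚ i) ≡ i
    inv-act i = trans (sym (*-act (inv a) a i)) (trans (cong (_·ₚ i) *-inverseˡ) (idP-act i))

    inv-*-cancel : (b : Perm n) → inv a * (a * b) ≡ b
    inv-*-cancel b = trans (sym (*-assoc (inv a) a b)) (trans (cong (_* b) *-inverseˡ) (*-identityˡ b))

    *-inv-cancel : (b : Perm n) → a * (inv a * b) ≡ b
    *-inv-cancel b = trans (sym (*-assoc a (inv a) b)) (trans (cong (_* b) *-inverseʳ) (*-identityˡ b))

    *-cancelˡ : {b c : Perm n} → a * b ≡ a * c → b ≡ c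
    *-cancelˡ eq = trans (sym (inv-*-cancel _)) (trans (cong (inv a *_) eq) (inv-*-cancel _))

    *-inv-cancelʳ : (b : Perm n) → (b * inv a) * a ≡ b
    *-inv-cancelʳ b = trans (*-assoc b (inv a) a) (trans (cong (b *_) *-inverseˡ) (*-identityʳ b))

    *-cancel-invʳ : (b : Perm n) → (b * a) * inv a ≡ b
    *-cancel-invʳ b = trans (*-assoc b a (inv a)) (trans (cong (b *_) *-inverseʳ) (*-identityʳ b))

    *-cancelʳ : {b c : Perm n} → b * a ≡ c * a → b ≡ c
    *-cancelʳ eq = trans (sym (*-cancel-invʳ _)) (trans (cong (_* inv a) eq) (*-cancel-invʳ _))

    left-translate-↭ : map (a *_) (elems K) ↭ elems K
    left-translate-↭ = unique⇒↭ (map-unique _ (λ _ _ → *-cancelˡ) (unique K)) (unique K)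
      (λ z∈ → let (x , x∈ , z≡) = ∈-map⁻ (a *_) z∈ in subst (_∈ˢ K) (sym z≡) (mul-closed K a∈ x∈))
      (λ {x} x∈ → subst (_∈ map (a *_) (elems K)) (*-inv-cancel x)
        (∈-map⁺ (a *_) (mul-closed K inv∈ x∈)))

    right-translate-↭ : map (_* a) (elems K) ↭ elems K
    right-translate-↭ = unique⇒↭ (map-unique _ (λ _ _ → *-cancelʳ) (unique K)) (unique K)
      (λ z∈ → let (x , x∈ , z≡) = ∈-map⁻ (_* a) z∈ in subst (_∈ˢ K) (sym z≡) (mul-closed K x∈ a∈))
      (λ {x} x∈ → subst (_∈ map (_* a) (elems K)) (*-inv-cancelʳ x)
        (∈-map⁺ (_* a) (mul-closed K x∈ inv∈)))

  Orbit : Fin n → Fin n → Set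
  Orbit i j = Any (λ a → a ·ₚ i ≡ j) (elems K)

  orbit? : (i j : Fin n) → Dec (Orbit i j)
  orbit? i j = Any.any? (λ a → (a ·ₚ i) Finₚ.≟ j) (elems K)

  orbit-refl : {i : Fin n} → Orbit i i
  orbit-refl = lose (has-id K) (idP-act _)

  orbit-sym : {i j : Fin n} → Orbit i j → Orbit j i
  orbit-sym o with a , a∈ , refl ← find o = lose (inv∈ a∈) (inv-act a∈ _)

  orbit-trans : {i j k : Fin n} → Orbit i j → Orbit j k → Orbit i k
  orbit-trans o o′ with a , a∈ , refl ← find o with b , b∈ , refl ← find o′ =
    lose (mul-closed K b∈ a∈) (*-act b a _)

-- Congruences

module Congruence (N : ℤ) where

  infix 4 _≈_
  record _≈_ (x y : ℤ) : Set where
    constructor mk≈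
    field divisible : N ∣ᶻ x - y
  open _≈_ public

  -- A congruence depends only on the difference of its sides. Later arguments add up known
  -- congruences and let a ring identity match the differences.
  ≈-by : ∀ {x y x′ y′} → x ≈ y → x - y ≡ x′ - y′ → x′ ≈ y′
  ≈-by (mk≈ d) eq = mk≈ (subst (N ∣ᶻ_) eq d)

  ≈-reflexive : ∀ {x y} → x ≡ y → x ≈ y
  ≈-reflexive {x} refl = mk≈ (dividesᶻ 0ℤ (ℤₚ.+-inverseʳ x))

  ≈-refl : ∀ {x} → x ≈ x
  ≈-refl = ≈-reflexive refl

  ≈-sym : ∀ {x y} → x ≈ y → y ≈ x
  ≈-sym {x} {y} (mk≈ d) = mk≈ (subst (N ∣ᶻ_) (lemma x y) (∣m⇒∣-m d))
    where
    lemma : ∀ x y → - (x - y) ≡ y - x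
    lemma = solve-∀

  infixl 6 _⟨+⟩_ _⟨-⟩_
  _⟨+⟩_ : ∀ {x y x′ y′} → x ≈ y → x′ ≈ y′ → x + x′ ≈ y + y′
  _⟨+⟩_ {x} {y} {x′} {y′} (mk≈ d) (mk≈ d′) = mk≈ (subst (N ∣ᶻ_) (lemma x y x′ y′) (∣m∣n⇒∣m+n d d′))
    where
    lemma : ∀ x y x′ y′ → (x - y) + (x′ - y′) ≡ (x + x′) - (y + y′)
    lemma = solve-∀

  _⟨-⟩_ : ∀ {x y x′ y′} → x ≈ y → x′ ≈ y′ → x - x′ ≈ y - y′
  _⟨-⟩_ {x} {y} {x′} {y′} (mk≈ d) (mk≈ d′) = mk≈ (subst (N ∣ᶻ_) (lemma x y x′ y′) (∣m∣n⇒∣m-n d d′))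
    where
    lemma : ∀ x y x′ y′ → (x - y) - (x′ - y′) ≡ (x - x′) - (y - y′)
    lemma = solve-∀

  ≈-trans : ∀ {x y z} → x ≈ y → y ≈ z → x ≈ z
  ≈-trans {x} {y} {z} p q = ≈-by (p ⟨+⟩ q) (lemma x y z)
    where
    lemma : ∀ x y z → (x + y) - (y + z) ≡ x - z
    lemma = solve-∀

  ∑-≈ : {A : Set} {f g : A → ℤ} (xs : List A) → (∀ {x} → x ∈ xs → f x ≈ g x) → ∑ xs f ≈ ∑ xs g
  ∑-≈ [] eq = ≈-refl
  ∑-≈ (x ∷ xs) eq = eq (here refl) ⟨+⟩ ∑-≈ xs (eq ∘ there)

-- Crossed homomorphisms of an abelian permutation group modulo constants

module AbelianSplitting (N : ℤ) {n : ℕ} (S : Subgroup n) where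

  open Congruence N
  open SubgroupProperties S

  module _
    (comm : ∀ {a b} → a ∈ˢ S → b ∈ˢ S → a * b ≡ b * a)
    (V : Perm n → Fin n → ℤ)
    -- Both sides are the defect of additivity of `V` at a point; its independence of the point says
    -- that `V` is a crossed homomorphism into functions modulo `N` and constants.
    (cocycle : ∀ {a b} → a ∈ˢ S → b ∈ˢ S → ∀ i j →
       V (a * b) i - V a (b ·ₚ i) - V b i ≈ V (a * b) j - V a (b ·ₚ j) - V b j)
    -- The lift of a that vanishes at i also vanishes at j, so the splittings over the stabilizers
    -- of i and j agree on their intersection.
    (compat : ∀ {a} → a ∈ˢ S → ∀ {i j} → a ·ₚ i ≡ i → a ·ₚ j ≡ j → V a i ≈ V a j)
    (cyclic-orbit : ∀ {e b i} → e ∈ˢ S → b ∈ˢ S → ¬ (e ·ₚ i ≡ i) → ∃[ k ] (b ·ₚ i ≡ (e ^ₚ k) ·ₚ i))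
    (i₁ i₂ i₃ : Fin n)
    -- General position: S is the product of the common stabilizer of i₁ and i₂ with the stabilizer
    -- of i₃. `move₁` says the same with i₁ and i₃ exchanged.
    (move₃ : ∀ {a} → a ∈ˢ S → ∃[ x ] (x ∈ˢ S × x ·ₚ i₁ ≡ i₁ × x ·ₚ i₂ ≡ i₂ × a ·ₚ i₃ ≡ x ·ₚ i₃))
    (move₁ : ∀ {a} → a ∈ˢ S → ∃[ y ] (y ∈ˢ S × y ·ₚ i₂ ≡ i₂ × y ·ₚ i₃ ≡ i₃ × a ·ₚ i₁ ≡ y ·ₚ i₁))
    where

    act-comm : ∀ {a b} → a ∈ˢ S → b ∈ˢ S → ∀ i → a ·ₚ (b ·ₚ i) ≡ b ·ₚ (a ·ₚ i)
    act-comm {a} {b} a∈ b∈ i =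
      trans (sym (*-act a b i)) (trans (cong (_·ₚ i) (comm a∈ b∈)) (*-act b a i))

    quotient-fix : ∀ {a} b → a ∈ˢ S → ∀ i → b ·ₚ i ≡ a ·ₚ i → (inv a * b) ·ₚ i ≡ i
    quotient-fix {a} b a∈ i eq =
      trans (*-act (inv a) b i) (trans (cong (inv a ·ₚ_) eq) (inv-act a∈ i))

    -- For x fixing i₁, the unique translate of V x by a constant that vanishes at i₁.
    E : Perm n → Fin n → ℤ
    E x i = V x i - V x i₁

    E-fix : ∀ {z} → z ∈ˢ S → z ·ₚ i₁ ≡ i₁ → z ·ₚ i₃ ≡ i₃ → E z i₃ ≈ 0ℤ
    E-fix {z} z∈ f₁ f₃ = ≈-by (compat z∈ f₃ f₁) (sym (ℤₚ.+-identityʳ (V z i₃ - V z i₁)))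

    E-* : ∀ {x z} → x ∈ˢ S → z ∈ˢ S → z ·ₚ i₁ ≡ i₁ → ∀ i → E (x * z) i ≈ E x (z ·ₚ i) + E z i
    E-* {x} {z} x∈ z∈ f₁ i = ≈-by (cocycle x∈ z∈ i i₁)
      (trans (cong (λ j → V (x * z) i - V x (z ·ₚ i) - V z i - (V (x * z) i₁ - V x j - V z i₁)) f₁)
        (lemma (V (x * z) i) (V x (z ·ₚ i)) (V z i) (V (x * z) i₁) (V x i₁) (V z i₁)))
      where
      lemma : ∀ a b c a′ b′ c′ → a - b - c - (a′ - b′ - c′) ≡ (a - a′) - ((b - b′) + (c - c′))
      lemma = solve-∀

    -- The quotient of y by x fixes i₁ and i₃, so its lift vanishes at both. This makes the choice
    -- made by `move₃` immaterial.
    E-cong : ∀ {x y} → x ∈ˢ S → y ∈ˢ S → x ·ₚ i₁ ≡ i₁ → y ·ₚ i₁ ≡ i₁ → y ·ₚ i₃ ≡ x ·ₚ i₃ →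
      E y i₃ ≈ E x i₃
    E-cong {x} {y} x∈ y∈ fx fy eq = ≈-trans
      (subst (λ u → E u i₃ ≈ E x (z ·ₚ i₃) + E z i₃) (*-inv-cancel x∈ y) (E-* x∈ z∈ z-fix₁ i₃))
      (≈-trans (≈-reflexive (cong (λ j → E x j + E z i₃) z-fix₃))
        (≈-trans (≈-refl {E x i₃} ⟨+⟩ E-fix z∈ z-fix₁ z-fix₃) (≈-reflexive (ℤₚ.+-identityʳ (E x i₃)))))
      where
      z : Perm n
      z = inv x * y
      z∈ : z ∈ˢ S
      z∈ = mul-closed S (inv∈ x∈) y∈
      z-fix₁ : z ·ₚ i₁ ≡ i₁
      z-fix₁ = quotient-fix y x∈ i₁ (trans fy (sym fx))
      z-fix₃ : z ·ₚ i₃ ≡ i₃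
      z-fix₃ = quotient-fix y x∈ i₃ eq

    -- The commutator pairing of the central extension defined by V: constant in i.
    Ω : Perm n → Perm n → Fin n → ℤ
    Ω a b i = V a (b ·ₚ i) + V b i - V b (a ·ₚ i) - V a i

    -- Since ab = ba, subtracting the two cocycle relations for this product cancels the values of
    -- `V` at it.
    Ω-const : ∀ {a b} → a ∈ˢ S → b ∈ˢ S → ∀ i j → Ω a b i ≈ Ω a b j
    Ω-const {a} {b} a∈ b∈ i j = ≈-by
      (subst (λ c → V c i - V b (a ·ₚ i) - V a i ≈ V c j - V b (a ·ₚ j) - V a j)
         (comm b∈ a∈) (cocycle b∈ a∈ i j) ⟨-⟩ cocycle a∈ b∈ i j)
      (lemma (V (a * b) i) (V (a * b) j) (V b (a ·ₚ i)) (V b (a ·ₚ j)) (V a i) (V a j)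
             (V a (b ·ₚ i)) (V a (b ·ₚ j)) (V b i) (V b j))
      where
      lemma : ∀ c c′ ba ba′ a a′ ab ab′ b b′ →
        (c - ba - a - (c - ab - b)) - (c′ - ba′ - a′ - (c′ - ab′ - b′))
        ≡ (ab + b - ba - a) - (ab′ + b′ - ba′ - a′)
      lemma = solve-∀

    -- By `Ω-const` the pairing may be evaluated at the common fixed point, where its four terms
    -- cancel.
    Ω-fix : ∀ {a b} → a ∈ˢ S → b ∈ˢ S → ∀ j → a ·ₚ j ≡ j → b ·ₚ j ≡ j → ∀ i → Ω a b i ≈ 0ℤ
    Ω-fix {a} {b} a∈ b∈ j fa fb i = ≈-trans (Ω-const a∈ b∈ i j) (≈-reflexive
      (trans (cong₂ (λ k l → V a k + V b j - V b l - V a j) fb fa) (lemma (V a j) (V b j))))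
      where
      lemma : ∀ x y → x + y - y - x ≡ 0ℤ
      lemma = solve-∀

    -- Additivity of the commutator pairing in its first argument. The vanishing for y is used at
    -- z·i and that for z at i, hence the quantification over points.
    Ω-* : ∀ {y z x} → y ∈ˢ S → z ∈ˢ S → x ∈ˢ S →
      (∀ i → Ω y x i ≈ 0ℤ) → (∀ i → Ω z x i ≈ 0ℤ) → ∀ i → Ω (y * z) x i ≈ 0ℤ
    Ω-* {y} {z} {x} y∈ z∈ x∈ p q i = ≈-by
      (cocycle y∈ z∈ (x ·ₚ i) i ⟨+⟩ p (z ·ₚ i) ⟨+⟩ q i)
      (trans (cong₂ (λ j k → V (y * z) (x ·ₚ i) - V y j - V z (x ·ₚ i)
                 + (V y (x ·ₚ (z ·ₚ i)) + V x (z ·ₚ i) - V x k - V y (z ·ₚ i))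
                 + Ω z x i - (V (y * z) i - V y (z ·ₚ i) - V z i + 0ℤ + 0ℤ))
               (act-comm z∈ x∈ i) (sym (*-act y z i)))
        (lemma (V (y * z) (x ·ₚ i)) (V y (x ·ₚ (z ·ₚ i))) (V z (x ·ₚ i)) (V x (z ·ₚ i))
          (V x ((y * z) ·ₚ i)) (V y (z ·ₚ i)) (V x i) (V z i) (V (y * z) i)))
      where
      lemma : ∀ yzx yxz zx xz xyz yz x z yzi →
        yzx - yxz - zx + (yxz + xz - xyz - yz) + (zx + x - xz - z) - (yzi - yz - z + 0ℤ + 0ℤ)
        ≡ (yzx + x - xyz - yzi) - 0ℤ
      lemma = solve-∀

    -- a is a product of an element fixing i₂ and one fixing i₁, as x does both.
    Ω-vanishes : ∀ {a x} → a ∈ˢ S → x ∈ˢ S → x ·ₚ i₁ ≡ i₁ → x ·ₚ i₂ ≡ i₂ → ∀ i → Ω a x i ≈ 0ℤ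
    Ω-vanishes {a} {x} a∈ x∈ f₁ f₂ i with y , y∈ , y-fix₂ , _ , eq ← move₁ a∈ =
      subst (λ b → Ω b x i ≈ 0ℤ) (*-inv-cancel y∈ a)
        (Ω-* y∈ z∈ x∈ (Ω-fix y∈ x∈ i₂ y-fix₂ f₂)
          (Ω-fix z∈ x∈ i₁ (quotient-fix a y∈ i₁ eq) f₁) i)
      where
      z∈ : (inv y * a) ∈ˢ S
      z∈ = mul-closed S (inv∈ y∈) a∈

    x[_] : ∀ {a} → a ∈ˢ S → Perm n
    x[ a∈ ] = proj₁ (move₃ a∈)

    module _ {a} (a∈ : a ∈ˢ S) where
      x∈ : x[ a∈ ] ∈ˢ S
      x∈ = proj₁ (proj₂ (move₃ a∈))
      x-fix₁ : x[ a∈ ] ·ₚ i₁ ≡ i₁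
      x-fix₁ = proj₁ (proj₂ (proj₂ (move₃ a∈)))
      x-fix₂ : x[ a∈ ] ·ₚ i₂ ≡ i₂
      x-fix₂ = proj₁ (proj₂ (proj₂ (proj₂ (move₃ a∈))))
      x-act₃ : a ·ₚ i₃ ≡ x[ a∈ ] ·ₚ i₃
      x-act₃ = proj₂ (proj₂ (proj₂ (proj₂ (move₃ a∈))))

    -- The translate of V a by a constant agreeing at i₃ with E of an element
    -- that fixes i₁, i₂ and acts on i₃ as a does.
    σ : ∀ {a} → a ∈ˢ S → Fin n → ℤ
    σ {a} a∈ i = V a i - V a i₃ + E x[ a∈ ] i₃

    -- Write a = xa q and b = xb q′ with q and q′ fixing i₃. Regrouping ab around xb xa moves xb
    -- past a, which costs Ω a xb, zero by `Ω-vanishes`. The lifts of xa and xb multiply because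
    -- both fix i₁.
    σ-* : ∀ {a b} (a∈ : a ∈ˢ S) (b∈ : b ∈ˢ S) (ab∈ : (a * b) ∈ˢ S) →
      ∀ i → σ ab∈ i ≈ σ a∈ (b ·ₚ i) + σ b∈ i
    σ-* {a} {b} a∈ b∈ ab∈ i = ≈-by
      (cocycle a∈ b∈ i i₃ ⟨+⟩ E-xab ⟨-⟩ Ω-vanishes a∈ (x∈ b∈) (x-fix₁ b∈) (x-fix₂ b∈) i₃)
      (trans
        (cong₂ (λ j k → V (a * b) i - V a (b ·ₚ i) - V b i + E x[ ab∈ ] i₃
                   - (V a (xb ·ₚ i₃) + V xb i₃ - V xb k - V a i₃)
                   - (V (a * b) i₃ - V a j - V b i₃ + (E xb (xa ·ₚ i₃) + E xa i₃) - 0ℤ))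
           (x-act₃ b∈) (x-act₃ a∈))
        (lemma (V (a * b) i) (V a (b ·ₚ i)) (V b i) (E x[ ab∈ ] i₃) (V a (xb ·ₚ i₃))
          (V xb i₃) (V xb (xa ·ₚ i₃)) (V a i₃) (V (a * b) i₃) (V b i₃) (V xb i₁) (E xa i₃)))
      where
      xa xb : Perm n
      xa = x[ a∈ ]
      xb = x[ b∈ ]
      xba∈ : (xb * xa) ∈ˢ S
      xba∈ = mul-closed S (x∈ b∈) (x∈ a∈)
      same : x[ ab∈ ] ·ₚ i₃ ≡ (xb * xa) ·ₚ i₃
      same = begin
        x[ ab∈ ] ·ₚ i₃     ≡⟨ x-act₃ ab∈ ⟨
        (a * b) ·ₚ i₃      ≡⟨ *-act a b i₃ ⟩
        a ·ₚ (b ·ₚ i₃)     ≡⟨ cong (a ·ₚ_) (x-act₃ b∈) ⟩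
        a ·ₚ (xb ·ₚ i₃)    ≡⟨ act-comm a∈ (x∈ b∈) i₃ ⟩
        xb ·ₚ (a ·ₚ i₃)    ≡⟨ cong (xb ·ₚ_) (x-act₃ a∈) ⟩
        xb ·ₚ (xa ·ₚ i₃)   ≡⟨ *-act xb xa i₃ ⟨
        (xb * xa) ·ₚ i₃    ∎
        where open ≡-Reasoning
      E-xab : E x[ ab∈ ] i₃ ≈ E xb (xa ·ₚ i₃) + E xa i₃
      E-xab = ≈-trans
        (E-cong xba∈ (x∈ ab∈) (*-fix xb xa (x-fix₁ b∈) (x-fix₁ a∈)) (x-fix₁ ab∈) same)
        (E-* (x∈ b∈) (x∈ a∈) (x-fix₁ a∈) i₃)
      lemma : ∀ abi ab b eab axb xb xbxa a ab₃ b₃ xb₁ exa →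
        abi - ab - b + eab - (axb + xb - xbxa - a)
          - (ab₃ - axb - b₃ + ((xbxa - xb₁) + exa) - 0ℤ)
        ≡ (abi - ab₃ + eab) - ((ab - a + exa) + (b - b₃ + (xb - xb₁)))
      lemma = solve-∀

    σ-fix-any : ∀ {a} (a∈ : a ∈ˢ S) i j → a ·ₚ i ≡ i → a ·ₚ j ≡ j → σ a∈ i ≈ 0ℤ → σ a∈ j ≈ 0ℤ
    σ-fix-any {a} a∈ i j fi fj σi = ≈-by (compat a∈ fj fi ⟨+⟩ σi)
      (lemma (V a i) (V a j) (V a i₃) (E x[ a∈ ] i₃))
      where
      lemma : ∀ vi vj v₃ e → vj + (vi - v₃ + e) - (vi + 0ℤ) ≡ (vj - v₃ + e) - 0ℤ
      lemma = solve-∀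

    σ-fix₃ : ∀ {z} (z∈ : z ∈ˢ S) → z ·ₚ i₃ ≡ i₃ → ∀ i → z ·ₚ i ≡ i → σ z∈ i ≈ 0ℤ
    σ-fix₃ {z} z∈ f₃ i fi = σ-fix-any z∈ i₃ i f₃ fi (≈-by
      (E-fix (x∈ z∈) (x-fix₁ z∈) (trans (sym (x-act₃ z∈)) f₃))
      (lemma (V z i₃) (E x[ z∈ ] i₃)))
      where
      lemma : ∀ v e → e - 0ℤ ≡ (v - v + e) - 0ℤ
      lemma = solve-∀

    σ-fix₁₂ : ∀ {z} (z∈ : z ∈ˢ S) → z ·ₚ i₁ ≡ i₁ → z ·ₚ i₂ ≡ i₂ → ∀ i → z ·ₚ i ≡ i → σ z∈ i ≈ 0ℤ
    σ-fix₁₂ {z} z∈ f₁ f₂ i fi = σ-fix-any z∈ i₁ i f₁ fi (≈-by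
      (E-cong z∈ (x∈ z∈) f₁ (x-fix₁ z∈) (sym (x-act₃ z∈)))
      (lemma (V z i₃) (V z i₁) (E x[ z∈ ] i₃)))
      where
      lemma : ∀ v₃ v₁ e → e - (v₃ - v₁) ≡ (v₁ - v₃ + e) - 0ℤ
      lemma = solve-∀

    -- Multiplicativity at a point fixed by the right factor: showing that `σ` extends the
    -- stabilizer splittings reduces to factoring a suitably.
    σ-factor : ∀ {a b} (a∈ : a ∈ˢ S) (b∈ : b ∈ˢ S) (q∈ : (inv b * a) ∈ˢ S) → ∀ i →
      (inv b * a) ·ₚ i ≡ i → σ b∈ i ≈ 0ℤ → σ q∈ i ≈ 0ℤ → σ a∈ i ≈ 0ℤ
    σ-factor {a} {b} a∈ b∈ q∈ i fi σb σq = ≈-trans (hom a∈ (*-inv-cancel b∈ a))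
      (≈-trans (≈-reflexive (cong (λ j → σ b∈ j + σ q∈ i) fi)) (σb ⟨+⟩ σq))
      where
      hom : ∀ {c} (c∈ : c ∈ˢ S) → b * (inv b * a) ≡ c →
        σ c∈ i ≈ σ b∈ ((inv b * a) ·ₚ i) + σ q∈ i
      hom c∈ refl = σ-* b∈ q∈ c∈ i

    σ-fix-x : ∀ {a} (a∈ : a ∈ˢ S) → ∀ i → a ·ₚ i ≡ i → x[ a∈ ] ·ₚ i ≡ i → σ a∈ i ≈ 0ℤ
    σ-fix-x {a} a∈ i fa fx = σ-factor a∈ (x∈ a∈) q∈ i fq
      (σ-fix₁₂ (x∈ a∈) (x-fix₁ a∈) (x-fix₂ a∈) i fx)
      (σ-fix₃ q∈ (quotient-fix a (x∈ a∈) i₃ (x-act₃ a∈)) i fq)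
      where
      q∈ : (inv x[ a∈ ] * a) ∈ˢ S
      q∈ = mul-closed S (inv∈ (x∈ a∈)) a∈
      fq : (inv x[ a∈ ] * a) ·ₚ i ≡ i
      fq = quotient-fix a (x∈ a∈) i (trans fa (sym fx))

    -- If x = x[ a∈ ] moves i, its powers are transitive on the orbit of i, so a is
    -- a product of y xᵏ fixing i, i₂ and of an element fixing i, i₁.
    σ-fix : ∀ {a} (a∈ : a ∈ˢ S) → ∀ i → a ·ₚ i ≡ i → σ a∈ i ≈ 0ℤ
    σ-fix {a} a∈ i fa with (x[ a∈ ] ·ₚ i) Finₚ.≟ i
    ... | yes fx = σ-fix-x a∈ i fa fx
    ... | no mx with y , y∈ , y-fix₂ , _ , eq ← move₁ a∈
                with k , inv-y≡ ← cyclic-orbit (x∈ a∈) (inv∈ y∈) mx =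
      σ-factor a∈ c∈ d∈ i fd
        (σ-fix-any c∈ i₂ i c-fix₂ fc (σ-fix-x c∈ i₂ c-fix₂ (x-fix₂ c∈)))
        (σ-fix-any d∈ i₁ i d-fix₁ fd (σ-fix-x d∈ i₁ d-fix₁ (x-fix₁ d∈)))
      where
      x c : Perm n
      x = x[ a∈ ]
      c = y * (x ^ₚ k)
      c∈ : c ∈ˢ S
      c∈ = mul-closed S y∈ (^ₚ-closed (x∈ a∈) k)
      d∈ : (inv c * a) ∈ˢ S
      d∈ = mul-closed S (inv∈ c∈) a∈
      fc : c ·ₚ i ≡ i
      fc = trans (*-act y (x ^ₚ k) i) (trans (cong (y ·ₚ_) (sym inv-y≡)) (act-inv y∈ i))
      fd : (inv c * a) ·ₚ i ≡ i
      fd = quotient-fix a c∈ i (trans fa (sym fc))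
      c-fix₂ : c ·ₚ i₂ ≡ i₂
      c-fix₂ = *-fix y (x ^ₚ k) y-fix₂ (^ₚ-fix x (x-fix₂ a∈) k)
      d-fix₁ : (inv c * a) ·ₚ i₁ ≡ i₁
      d-fix₁ = quotient-fix a c∈ i₁ (trans eq
        (sym (trans (*-act y (x ^ₚ k) i₁) (cong (y ·ₚ_) (^ₚ-fix x (x-fix₁ a∈) k)))))

    -- The two elements differ by one fixing i, where `σ-fix` applies. So `σ` descends to a function
    -- on the orbit of i.
    σ-cong : ∀ {s t} (s∈ : s ∈ˢ S) (t∈ : t ∈ˢ S) i → t ·ₚ i ≡ s ·ₚ i → σ t∈ i ≈ σ s∈ i
    σ-cong {s} {t} s∈ t∈ i eq = ≈-trans (hom t∈ (*-inv-cancel s∈ t))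
      (≈-trans (≈-reflexive (cong (λ j → σ s∈ j + σ z∈ i) fz))
        (≈-trans (≈-refl {σ s∈ i} ⟨+⟩ σ-fix z∈ i fz) (≈-reflexive (ℤₚ.+-identityʳ (σ s∈ i)))))
      where
      z∈ : (inv s * t) ∈ˢ S
      z∈ = mul-closed S (inv∈ s∈) t∈
      fz : (inv s * t) ·ₚ i ≡ i
      fz = quotient-fix t s∈ i eq
      hom : ∀ {c} (c∈ : c ∈ˢ S) → s * (inv s * t) ≡ c →
        σ c∈ i ≈ σ s∈ ((inv s * t) ·ₚ i) + σ z∈ i
      hom c∈ refl = σ-* s∈ z∈ c∈ i

    -- On the orbit of a representative ρ, `w` at s·ρ is `σ` of s at ρ, and multiplicativity of `σ`
    -- gives σ a = w ∘ a - w. As `σ` of a and `V` a differ by a constant, comparing two points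
    -- removes that constant.
    splitting : ∃[ w ] (∀ {a} → a ∈ˢ S → ∀ i j →
      V a i - w (a ·ₚ i) + w i ≈ V a j - w (a ·ₚ j) + w j)
    splitting = w , λ {a} a∈ i j → ≈-by (w-spec a∈ i ⟨-⟩ w-spec a∈ j)
      (lemma (V a i) (V a j) (V a i₃) (E x[ a∈ ] i₃) (w (a ·ₚ i)) (w i) (w (a ·ₚ j)) (w j))
      where
      lemma : ∀ vi vj v₃ e wai wi waj wj →
        ((vi - v₃ + e) - (vj - v₃ + e)) - ((wai - wi) - (waj - wj))
        ≡ (vi - wai + wi) - (vj - waj + wj)
      lemma = solve-∀
      reps : ∃[ T ] IsTransversal Orbit (allFin n) T
      reps = transversal Orbit orbit? orbit-sym (allFin n) (λ _ → orbit-refl)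
      open IsTransversal (proj₂ reps)
      ρ : Fin n → Fin n
      ρ i = proj₁ (T-covers (∈-allFin i))
      ρ∈ : ∀ i → ρ i ∈ proj₁ reps
      ρ∈ i = proj₁ (proj₂ (T-covers (∈-allFin i)))
      ρ-orbit : ∀ i → Orbit (ρ i) i
      ρ-orbit i = proj₂ (proj₂ (T-covers (∈-allFin i)))
      s : Fin n → Perm n
      s i = proj₁ (find (ρ-orbit i))
      s∈ : ∀ i → s i ∈ˢ S
      s∈ i = proj₁ (proj₂ (find (ρ-orbit i)))
      s-act : ∀ i → s i ·ₚ ρ i ≡ i
      s-act i = proj₂ (proj₂ (find (ρ-orbit i)))
      w : Fin n → ℤ
      w i = σ (s∈ i) (ρ i)
      ρ-act : ∀ {a} → a ∈ˢ S → ∀ i → ρ (a ·ₚ i) ≡ ρ i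
      ρ-act a∈ i = T-apart (ρ∈ _) (ρ∈ i)
        (orbit-trans (ρ-orbit _) (orbit-trans (orbit-sym (lose a∈ refl)) (orbit-sym (ρ-orbit i))))
      w-spec : ∀ {a} (a∈ : a ∈ˢ S) i → σ a∈ i ≈ w (a ·ₚ i) - w i
      w-spec {a} a∈ i = ≈-by (≈-sym (≈-trans step₁ (σ-* a∈ (s∈ i) as∈ (ρ i))))
        (trans (cong (λ j → σ a∈ j + w i - w (a ·ₚ i)) (s-act i)) (lemma₁ (σ a∈ i) (w i) _))
        where
        as∈ : (a * s i) ∈ˢ S
        as∈ = mul-closed S a∈ (s∈ i)
        step₁ : w (a ·ₚ i) ≈ σ as∈ (ρ i)
        step₁ = subst (λ j → σ (s∈ (a ·ₚ i)) j ≈ σ as∈ (ρ i)) (sym (ρ-act a∈ i))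
          (σ-cong as∈ (s∈ (a ·ₚ i)) (ρ i)
            (trans (cong (s (a ·ₚ i) ·ₚ_) (sym (ρ-act a∈ i))) (trans (s-act (a ·ₚ i))
              (sym (trans (*-act a (s i) (ρ i)) (cong (a ·ₚ_) (s-act i)))))))
        lemma₁ : ∀ x y z → x + y - z ≡ x - (z - y)
        lemma₁ = solve-∀

-- Cochains as functions on points

-- The coboundary equation in J with its unknown constant eliminated: F - dΦ takes the same value at
-- any two points. The action is on the right, so the translated term is Φ a at b·i.
PtCob : ∀ {n} → Subgroup n → (Perm n → Perm n → Fin n → ℤ) → (Perm n → Fin n → ℤ) → Set
PtCob K F Φ = ∀ {a b} → a ∈ˢ K → b ∈ˢ K → ∀ i j →
  F a b i - (Φ b i - Φ (a * b) i + Φ a (b ·ₚ i)) ≡ F a b j - (Φ b j - Φ (a * b) j + Φ a (b ·ₚ j))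

-- A class killed by two coprime integers is zero.
PtCob-combine : ∀ {n} (K : Subgroup n) F Φ Ψ (x c y d : ℤ) → x · c + y · d ≡ ℤ.1ℤ →
  PtCob K (λ a b i → c · F a b i) Φ → PtCob K (λ a b i → d · F a b i) Ψ →
  ∃[ Θ ] PtCob K F Θ
PtCob-combine K F Φ Ψ x c y d bezout cobΦ cobΨ = (λ a i → x · Φ a i + y · Ψ a i) , cob
  where
  module _ {a b} (a∈ : a ∈ˢ K) (b∈ : b ∈ˢ K) where
    open ≡-Reasoning
    D DΦ DΨ : _ → ℤ
    D i = F a b i - ((x · Φ b i + y · Ψ b i) - (x · Φ (a * b) i + y · Ψ (a * b) i)
      + (x · Φ a (b ·ₚ i) + y · Ψ a (b ·ₚ i)))
    DΦ i = c · F a b i - (Φ b i - Φ (a * b) i + Φ a (b ·ₚ i))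
    DΨ i = d · F a b i - (Ψ b i - Ψ (a * b) i + Ψ a (b ·ₚ i))
    lemma : ∀ x c y d f p q r p′ q′ r′ →
      (x · c + y · d) · f - ((x · p + y · p′) - (x · q + y · q′) + (x · r + y · r′))
      ≡ x · (c · f - (p - q + r)) + y · (d · f - (p′ - q′ + r′))
    lemma = solve-∀
    split : ∀ i → D i ≡ x · DΦ i + y · DΨ i
    split i = trans
      (cong (_- ((x · Φ b i + y · Ψ b i) - (x · Φ (a * b) i + y · Ψ (a * b) i)
          + (x · Φ a (b ·ₚ i) + y · Ψ a (b ·ₚ i))))
        (trans (sym (ℤₚ.*-identityˡ (F a b i))) (cong (_· F a b i) (sym bezout))))
      (lemma x c y d (F a b i) (Φ b i) (Φ (a * b) i) (Φ a (b ·ₚ i))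
        (Ψ b i) (Ψ (a * b) i) (Ψ a (b ·ₚ i)))
    cob : ∀ i j → D i ≡ D j
    cob i j = begin
      D i                 ≡⟨ split i ⟩
      x · DΦ i + y · DΨ i ≡⟨ cong₂ (λ u v → x · u + y · v) (cobΦ a∈ b∈ i j) (cobΨ a∈ b∈ i j) ⟩
      x · DΦ j + y · DΨ j ≡⟨ split j ⟨
      D j                 ∎

module Points {n : ℕ} (G H : Subgroup n) (transitive : IsTransitive G)
  (i₀ : Fin n) (stab : IsPointStabilizer G H i₀) where

  open SubgroupProperties G

  γ : Fin n → Perm n
  γ j = proj₁ (transitive j i₀)

  γ∈ : ∀ j → γ j ∈ˢ G
  γ∈ j = proj₁ (proj₂ (transitive j i₀))

  γ-act : ∀ j → γ j ·ₚ j ≡ i₀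
  γ-act j = proj₂ (proj₂ (transitive j i₀))

  -- The cosets of H correspond to points, H y being determined by the point that y sends to i₀.
  -- Hence an element of the induced module is a function on points.
  ind-cong : ∀ {x} → IsInd G H x → ∀ {y y′} j → y ∈ˢ G → y′ ∈ˢ G →
    y ·ₚ j ≡ i₀ → y′ ·ₚ j ≡ i₀ → x y ≡ x y′
  ind-cong {x} ind {y} {y′} j y∈ y′∈ yj y′j =
    trans (cong x (sym (*-inv-cancelʳ y′∈ y))) (ind h∈ y′∈)
    where
    h∈ : (y * inv y′) ∈ˢ H
    h∈ = Equivalence.from (stab _) (mul-closed G y∈ (inv∈ y′∈) ,
      trans (*-act y (inv y′) i₀)
        (trans (cong (λ k → y ·ₚ (inv y′ ·ₚ k)) (sym y′j)) (trans (cong (y ·ₚ_) (inv-act y′∈ j)) yj)))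

  -- Evaluating at points moved by the group elements makes G act on functions
  -- on points by precomposition from the right, so that no inverses occur.
  pt₁ : (Perm n → Cochain n) → Perm n → Fin n → ℤ
  pt₁ φ a i = φ a (γ (a ·ₚ i))

  pt₂ : Cochain2 n → Perm n → Perm n → Fin n → ℤ
  pt₂ f a b i = f a b (γ (a ·ₚ (b ·ₚ i)))

  toPtCob : ∀ K f → K ≤ˢ G → IsCoboundaryOn G H K f → ∃[ Φ ] PtCob K (pt₂ f) Φ
  toPtCob K f K≤G (φ , ind , cob) = pt₁ φ , λ a∈ b∈ i j →
    trans (value a∈ b∈ i) (sym (value a∈ b∈ j))
    where
    value : ∀ {a b} (a∈ : a ∈ˢ K) (b∈ : b ∈ˢ K) i →
      pt₂ f a b i - (pt₁ φ b i - pt₁ φ (a * b) i + pt₁ φ a (b ·ₚ i)) ≡ proj₁ (cob a∈ b∈)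
    value {a} {b} a∈ b∈ i = begin
      f a b z - (pt₁ φ b i - pt₁ φ (a * b) i + φ a z)
        ≡⟨ cong (_- (pt₁ φ b i - pt₁ φ (a * b) i + φ a z)) (proj₂ (cob a∈ b∈) (γ∈ _)) ⟩
      φ b (z * a) - φ (a * b) z + φ a z + c - (pt₁ φ b i - pt₁ φ (a * b) i + φ a z)
        ≡⟨ cong₂ (λ u v → u - φ (a * b) z + φ a z + c - (pt₁ φ b i - v + φ a z))
             (ind-cong (ind b∈) (b ·ₚ i) (mul-closed G (γ∈ _) (K≤G a∈)) (γ∈ _)
               (trans (*-act z a _) (γ-act _)) (γ-act _))
             (cong (λ k → φ (a * b) (γ k)) (*-act a b i)) ⟩
      pt₁ φ b i - φ (a * b) z + φ a z + c - (pt₁ φ b i - φ (a * b) z + φ a z)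
        ≡⟨ lemma (pt₁ φ b i) (φ (a * b) z) (φ a z) c ⟩
      c ∎
      where
      open ≡-Reasoning
      z : Perm n
      z = γ (a ·ₚ (b ·ₚ i))
      c : ℤ
      c = proj₁ (cob a∈ b∈)
      lemma : ∀ p q r c → p - q + r + c - (p - q + r) ≡ c
      lemma = solve-∀

  -- The point sent to i₀ (junk value i₀ when y is not surjective).
  preimage : Perm n → Fin n
  preimage y with Finₚ.any? (λ j → (y ·ₚ j) Finₚ.≟ i₀)
  ... | yes (j , _) = j
  ... | no _ = i₀

  preimage-unique : ∀ {y} → y ∈ˢ G → ∀ j → y ·ₚ j ≡ i₀ → preimage y ≡ j
  preimage-unique {y} y∈ j eq with Finₚ.any? (λ j → (y ·ₚ j) Finₚ.≟ i₀)
  ... | yes (k , yk) = perms G y∈ k j (trans yk (sym eq))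
  ... | no none = ⊥-elim (none (j , eq))

  fromPtCob : ∀ f → (∀ {a b} → a ∈ˢ G → b ∈ˢ G → IsInd G H (f a b)) →
    ∃[ Φ ] PtCob G (pt₂ f) Φ → IsCoboundaryOn G H G f
  fromPtCob f f-ind (Φ , cob) = φ , φ-ind , φ-cob
    where
    φ : Perm n → Cochain n
    φ a z = Φ a (preimage (z * a))
    φ-ind : ∀ {a} → a ∈ˢ G → IsInd G H (φ a)
    φ-ind {a} a∈ {h} {z} h∈ z∈ = cong (Φ a) (trans
      (preimage-unique (mul-closed G (mul-closed G h∈G z∈) a∈) j
        (trans (cong (_·ₚ j) (*-assoc h z a)) (trans (*-act h (z * a) j) (trans (cong (h ·ₚ_) zaj) h-fix))))
      (sym (preimage-unique za∈ j zaj)))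
      where
      h∈G : h ∈ˢ G
      h∈G = proj₁ (Equivalence.to (stab h) h∈)
      h-fix : h ·ₚ i₀ ≡ i₀
      h-fix = proj₂ (Equivalence.to (stab h) h∈)
      za∈ : (z * a) ∈ˢ G
      za∈ = mul-closed G z∈ a∈
      j : Fin n
      j = inv (z * a) ·ₚ i₀
      zaj : (z * a) ·ₚ j ≡ i₀
      zaj = act-inv za∈ i₀
    φ-cob : ∀ {a b} → a ∈ˢ G → b ∈ˢ G → f a b ≈J[ G ] ((act a (φ b) ⊖ φ (a * b)) ⊕ φ a)
    φ-cob {a} {b} a∈ b∈ = c , eq
      where
      open ≡-Reasoning
      c : ℤ
      c = pt₂ f a b i₀ - (Φ b i₀ - Φ (a * b) i₀ + Φ a (b ·ₚ i₀))
      eq : ∀ {z} → z ∈ˢ G → f a b z ≡ φ b (z * a) - φ (a * b) z + φ a z + c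
      eq {z} z∈ = begin
        f a b z
          ≡⟨ ind-cong (f-ind a∈ b∈) (a ·ₚ (b ·ₚ j)) z∈ (γ∈ _) zabj (γ-act _) ⟩
        pt₂ f a b j
          ≡⟨ lemma (pt₂ f a b j) (Φ b j - Φ (a * b) j + Φ a (b ·ₚ j)) ⟩
        Φ b j - Φ (a * b) j + Φ a (b ·ₚ j) + (pt₂ f a b j - (Φ b j - Φ (a * b) j + Φ a (b ·ₚ j)))
          ≡⟨ cong (Φ b j - Φ (a * b) j + Φ a (b ·ₚ j) +_) (cob a∈ b∈ j i₀) ⟩
        Φ b j - Φ (a * b) j + Φ a (b ·ₚ j) + c
          ≡⟨ cong (_+ c) (cong₂ _+_ (cong₂ _-_ (cong (Φ b) pre₁) (cong (Φ (a * b)) pre₂)) (cong (Φ a) pre₃)) ⟨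
        φ b (z * a) - φ (a * b) z + φ a z + c ∎
        where
        lemma : ∀ x y → x ≡ y + (x - y)
        lemma = solve-∀
        zab∈ : (z * (a * b)) ∈ˢ G
        zab∈ = mul-closed G z∈ (mul-closed G a∈ b∈)
        j : Fin n
        j = inv (z * (a * b)) ·ₚ i₀
        pre₂ : preimage (z * (a * b)) ≡ j
        pre₂ = preimage-unique zab∈ j (act-inv zab∈ i₀)
        pre₁ : preimage ((z * a) * b) ≡ j
        pre₁ = trans (cong preimage (*-assoc z a b)) pre₂
        zabj : z ·ₚ (a ·ₚ (b ·ₚ j)) ≡ i₀
        zabj = trans (cong (z ·ₚ_) (sym (*-act a b j)))
          (trans (sym (*-act z (a * b) j)) (act-inv zab∈ i₀))
        pre₃ : preimage (z * a) ≡ b ·ₚ j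
        pre₃ = preimage-unique (mul-closed G z∈ a∈) (b ·ₚ j) (trans (*-act z a _) zabj)

  -- The classical averaging: the cocycle identity is summed over its third argument, and left
  -- translation by b reindexes the term containing bc.
  order-kills : ∀ {f} → Is2Cocycle G H f → IsCoboundaryOn G H G (scale2 (order G) f)
  order-kills {f} (f-ind , f-cocycle) = u ,
    (λ a∈ h∈ y∈ → ∑-cong (elems G) λ c∈ → f-ind a∈ c∈ h∈ y∈) , cob
    where
    u : Perm n → Cochain n
    u a z = ∑ (elems G) λ c → f a c z
    cob : ∀ {a b} → a ∈ˢ G → b ∈ˢ G →
      scale2 (order G) f a b ≈J[ G ] ((act a (u b) ⊖ u (a * b)) ⊕ u a)
    -- The cocycle identity holds only up to a constant for each c. That constant is read off at
    -- `idP`, and the sum of these values is the constant of the coboundary.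
    cob {a} {b} a∈ b∈ = - ∑ (elems G) (κ idP) , λ {z} z∈ → begin
      ℤ.+ order G · f a b z
        ≡⟨ lemma (u b (z * a)) (u (a * b) z) (u a z) (ℤ.+ order G · f a b z) ⟩
      rhs z - (rhs z - ℤ.+ order G · f a b z)
        ≡⟨ cong (λ s → rhs z - s) (∑κ z) ⟨
      rhs z - ∑ (elems G) (κ z)
        ≡⟨ cong (λ s → rhs z - s) (∑-cong (elems G) λ c∈ → κ-const z∈ c∈) ⟩
      rhs z - ∑ (elems G) (κ idP) ∎
      where
      open ≡-Reasoning
      rhs : Perm n → ℤ
      rhs z = u b (z * a) - u (a * b) z + u a z
      lemma : ∀ p q r s → s ≡ (p - q + r) - (p - q + r - s)
      lemma = solve-∀
      κ : Perm n → Perm n → ℤ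
      κ z c = f b c (z * a) - f (a * b) c z + f a (b * c) z - f a b z
      κ-const : ∀ {z c} → z ∈ˢ G → c ∈ˢ G → κ z c ≡ κ idP c
      κ-const z∈ c∈ = trans (proj₂ (f-cocycle a∈ b∈ c∈) z∈) (sym (proj₂ (f-cocycle a∈ b∈ c∈) (has-id G)))
      ∑κ : ∀ z → ∑ (elems G) (κ z) ≡ rhs z - ℤ.+ order G · f a b z
      ∑κ z = begin
        ∑ (elems G) (κ z)
          ≡⟨ ∑-distrib-- _ _ (elems G) ⟩
        ∑ (elems G) (λ c → f b c (z * a) - f (a * b) c z + f a (b * c) z) - ∑ (elems G) (λ _ → f a b z)
          ≡⟨ cong₂ _-_
              (trans (∑-distrib-+ _ _ (elems G)) (cong₂ _+_ (∑-distrib-- _ _ (elems G))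
                (trans (sym (∑-map (b *_) (λ c → f a c z) (elems G)))
                       (∑-↭ (λ c → f a c z) (left-translate-↭ b∈)))))
              (∑-const (f a b z) (elems G)) ⟩
        rhs z - ℤ.+ order G · f a b z ∎

-- Transfer from S to G

module Cosets {n : ℕ} (G S : Subgroup n) (S≤G : S ≤ˢ G) where

  open SubgroupProperties G
  module S = SubgroupProperties S

  -- Right cosets S a are the right choice here, as the cocycle relation at the product s a compares
  -- the values there and at a.
  record _~_ (a b : Perm n) : Set where
    constructor mk~
    field same-coset : Any (λ s → s * a ≡ b) (elems S)
  open _~_

  _~?_ : ∀ a b → Dec (a ~ b)
  a ~? b = map′ mk~ same-coset (Any.any? (λ s → (s * a) ≟ₚ b) (elems S))

  ~-refl : ∀ {a} → a ~ a
  ~-refl = mk~ (lose (has-id S) (*-identityˡ _))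

  ~-sym : ∀ {a b} → a ~ b → b ~ a
  ~-sym a~b with s , s∈ , refl ← find (same-coset a~b) = mk~ (lose (S.inv∈ s∈) (S.inv-*-cancel s∈ _))

  ~-trans : ∀ {a b c} → a ~ b → b ~ c → a ~ c
  ~-trans {a} a~b b~c with s , s∈ , refl ← find (same-coset a~b) with t , t∈ , refl ← find (same-coset b~c) =
    mk~ (lose (mul-closed S t∈ s∈) (*-assoc t s a))

  ~-*ʳ : ∀ {a b} c → a ~ b → (a * c) ~ (b * c)
  ~-*ʳ {a} c a~b with s , s∈ , refl ← find (same-coset a~b) = mk~ (lose s∈ (sym (*-assoc s a c)))

  cosets : ∃[ T ] IsTransversal _~_ (elems G) T
  cosets = transversal _~_ _~?_ ~-sym (elems G) (λ _ → ~-refl)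

  T : List (Perm n)
  T = proj₁ cosets

  open IsTransversal (proj₂ cosets)

  order-*-index : order S ℕ.* length T ≡ order G
  order-*-index = length-product _*_ (unique S) T-distinct (unique G)
    (λ s∈ t∈ → mul-closed G (S≤G s∈) (T⊆ t∈))
    (λ a∈ → let (t , t∈ , t~a) = T-covers a∈ ; (s , s∈ , eq) = find (same-coset t~a) in s , t , s∈ , t∈ , sym eq)
    inj
    where
    inj : ∀ {s t s′ t′} → s ∈ˢ S → t ∈ T → s′ ∈ˢ S → t′ ∈ T → s * t ≡ s′ * t′ → s ≡ s′ × t ≡ t′
    inj {s} {t} s∈ t∈ s′∈ t′∈ eq
      with refl ← T-apart t∈ t′∈ (~-trans (mk~ (lose s∈ eq)) (~-sym (mk~ (lose s′∈ refl)))) =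
      *-cancelʳ (T⊆ t∈) eq , refl

  rep : Perm n → Perm n
  rep a with Any.any? (_~? a) T
  ... | yes some = proj₁ (find some)
  ... | no _ = a

  rep-spec : ∀ {a} → a ∈ˢ G → rep a ∈ T × rep a ~ a
  rep-spec {a} a∈ with Any.any? (_~? a) T
  ... | yes some = proj₂ (find some)
  ... | no none = let (t , t∈ , t~a) = T-covers a∈ in ⊥-elim (none (lose t∈ t~a))

  translate-↭ : ∀ {b} → b ∈ˢ G → map (λ t → rep (t * b)) T ↭ T
  translate-↭ {b} b∈ = unique⇒↭ (map-unique _ inj T-distinct) T-distinct into onto
    where
    tb∈ : ∀ {t} → t ∈ T → (t * b) ∈ˢ G
    tb∈ t∈ = mul-closed G (T⊆ t∈) b∈
    inj : ∀ {s t} → s ∈ T → t ∈ T → rep (s * b) ≡ rep (t * b) → s ≡ t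
    inj {s} {t} s∈ t∈ eq = T-apart s∈ t∈ (subst₂ _~_ (*-cancel-invʳ b∈ s) (*-cancel-invʳ b∈ t)
      (~-*ʳ (inv b) (~-trans (~-sym (proj₂ (rep-spec (tb∈ s∈))))
        (subst (_~ (t * b)) (sym eq) (proj₂ (rep-spec (tb∈ t∈)))))))
    into : ∀ {a} → a ∈ map (λ t → rep (t * b)) T → a ∈ T
    into a∈ with t , t∈ , refl ← ∈-map⁻ (λ t → rep (t * b)) a∈ = proj₁ (rep-spec (tb∈ t∈))
    onto : ∀ {t} → t ∈ T → t ∈ map (λ t → rep (t * b)) T
    onto {t} t∈ = subst (_∈ map (λ t → rep (t * b)) T)
      (T-apart (proj₁ rs′) t∈ (~-trans (proj₂ rs′)
        (subst ((rep (t * inv b) * b) ~_) (*-inv-cancelʳ b∈ t) (~-*ʳ b (proj₂ rs)))))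
      (∈-map⁺ (λ t → rep (t * b)) (proj₁ rs))
      where
      rs : rep (t * inv b) ∈ T × rep (t * inv b) ~ (t * inv b)
      rs = rep-spec (mul-closed G (T⊆ t∈) (inv∈ b∈))
      rs′ : rep (rep (t * inv b) * b) ∈ T × rep (rep (t * inv b) * b) ~ (rep (t * inv b) * b)
      rs′ = rep-spec (tb∈ (proj₁ rs))

  module Transfer (N : ℤ) .{{N≢0 : ℤ.NonZero N}} (i₀ : Fin n)
    (F : Perm n → Perm n → Fin n → ℤ) (V : Perm n → Fin n → ℤ)
    (V-cob : PtCob G (λ a b i → N · F a b i) V) where

    open Congruence N

    module _ (w : Fin n → ℤ)
      (V-split : ∀ {a} → a ∈ˢ S → ∀ i j → V a i - w (a ·ₚ i) + w i ≈ V a j - w (a ·ₚ j) + w j)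
      where

      r : ℤ
      r = ℤ.+ length T

      V₀ : Perm n → Fin n → ℤ
      V₀ a i = V a i - w (a ·ₚ i) + w i

      V₀-cocycle : ∀ {a b} → a ∈ˢ G → b ∈ˢ G → ∀ i j →
        V₀ (a * b) i - V₀ a (b ·ₚ i) - V₀ b i ≈ V₀ (a * b) j - V₀ a (b ·ₚ j) - V₀ b j
      V₀-cocycle {a} {b} a∈ b∈ i j = mk≈ (dividesᶻ (F a b j - F a b i) (begin
        C i - C j ≡⟨ cong₂ _-_ (C≡ i) (C≡ j) ⟩
        (D i - N · F a b i) - (D j - N · F a b j)
          ≡⟨ cong (λ d → (d - N · F a b i) - (D j - N · F a b j)) (V-cob a∈ b∈ i j) ⟩
        (D j - N · F a b i) - (D j - N · F a b j)
          ≡⟨ lemma (D j) N (F a b i) (F a b j) ⟩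
        (F a b j - F a b i) · N ∎))
        where
        open ≡-Reasoning
        C D : Fin n → ℤ
        C i = V₀ (a * b) i - V₀ a (b ·ₚ i) - V₀ b i
        D i = N · F a b i - (V b i - V (a * b) i + V a (b ·ₚ i))
        lemma : ∀ d n f f′ → (d - n · f) - (d - n · f′) ≡ (f′ - f) · n
        lemma = solve-∀
        lemma₁ : ∀ vab va vb f wab wb wi →
          (vab - wab + wi) - (va - wab + wb) - (vb - wb + wi) ≡ (f - (vb - vab + va)) - f
        lemma₁ = solve-∀
        C≡ : ∀ i → C i ≡ D i - N · F a b i
        C≡ i = trans
          (cong (λ k → V (a * b) i - w k + w i - V₀ a (b ·ₚ i) - V₀ b i) (*-act a b i))
          (lemma₁ (V (a * b) i) (V a (b ·ₚ i)) (V b i) (N · F a b i)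
            (w (a ·ₚ (b ·ₚ i))) (w (b ·ₚ i)) (w i))

      -- Subtracting the coboundary of `w` makes `V₀` constant on S modulo `N`, so by the cocycle
      -- relation it descends to S∖G up to constants.
      V₀-coset : ∀ {a b} → a ∈ˢ G → a ~ b → ∀ i j → V₀ a i - V₀ b i ≈ V₀ a j - V₀ b j
      V₀-coset {a} a∈ a~b i j with s , s∈ , refl ← find (same-coset a~b) =
        ≈-by (≈-sym (V₀-cocycle (S≤G s∈) a∈ i j ⟨+⟩ V-split s∈ (a ·ₚ i) (a ·ₚ j)))
          (lemma (V₀ (s * a) i) (V₀ s (a ·ₚ i)) (V₀ a i) (V₀ (s * a) j) (V₀ s (a ·ₚ j)) (V₀ a j))
        where
        lemma : ∀ x y z x′ y′ z′ →
          (x′ - y′ - z′ + y′) - (x - y - z + y) ≡ (z - x) - (z′ - x′)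
        lemma = solve-∀

      W : Fin n → ℤ
      W i = ∑ T λ t → V₀ t i

      Y : Perm n → Fin n → ℤ
      Y b i = r · V₀ b i + W (b ·ₚ i) - W i

      -- Sum the cocycle relation for t and b over t in `T`. Replacing tb by its representative is
      -- harmless by `V₀-coset` and permutes `T`; the sum then expresses r V₀ b as a coboundary of
      -- `W` modulo `N` and constants.
      Y-const : ∀ {b} → b ∈ˢ G → ∀ i j → Y b i ≈ Y b j
      Y-const {b} b∈ i j = ≈-by (≈-sym (∑-≈ T term))
        (trans (cong₂ _-_ (total j) (total i))
          (lemma (W j) (W (b ·ₚ j)) (r · V₀ b j) (W i) (W (b ·ₚ i)) (r · V₀ b i)))
        where
        q : Fin n → Perm n → ℤ
        q i t = V₀ (rep (t * b)) i - V₀ t (b ·ₚ i) - V₀ b i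
        term : ∀ {t} → t ∈ T → q i t ≈ q j t
        term {t} t∈ = ≈-by
          (V₀-cocycle (T⊆ t∈) b∈ i j ⟨+⟩
            V₀-coset (T⊆ (proj₁ rs)) (proj₂ rs) i j)
          (lemma₁ (V₀ (t * b) i) (V₀ t (b ·ₚ i)) (V₀ b i) (V₀ (rep (t * b)) i)
                  (V₀ (t * b) j) (V₀ t (b ·ₚ j)) (V₀ b j) (V₀ (rep (t * b)) j))
          where
          rs : rep (t * b) ∈ T × rep (t * b) ~ (t * b)
          rs = rep-spec (mul-closed G (T⊆ t∈) b∈)
          lemma₁ : ∀ p x y c p′ x′ y′ c′ →
            (p - x - y + (c - p)) - (p′ - x′ - y′ + (c′ - p′)) ≡ (c - x - y) - (c′ - x′ - y′)
          lemma₁ = solve-∀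
        total : ∀ i → ∑ T (q i) ≡ W i - W (b ·ₚ i) - r · V₀ b i
        total i = trans (∑-distrib-- _ _ T) (cong₂ _-_
          (trans (∑-distrib-- _ _ T) (cong (_- W (b ·ₚ i))
            (trans (sym (∑-map (λ t → rep (t * b)) (λ t → V₀ t i) T))
              (∑-↭ (λ t → V₀ t i) (translate-↭ b∈)))))
          (∑-const (V₀ b i) T))
        lemma : ∀ p x y p′ x′ y′ →
          (p - x - y) - (p′ - x′ - y′) ≡ (y′ + x′ - p′) - (y + x - p)
        lemma = solve-∀

      -- The quotient of Y b by `N` after normalization to zero at i₀; outside G the value 0 is a
      -- default.
      Φ : Perm n → Fin n → ℤ
      Φ b i with Any.any? (b ≟ₚ_) (elems G)
      ... | yes b∈ = _∣ᶻ_.quotient (divisible (Y-const b∈ i i₀))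
      ... | no _ = 0ℤ

      Φ-spec : ∀ {b} → b ∈ˢ G → ∀ i → Φ b i · N ≡ Y b i - Y b i₀
      Φ-spec {b} b∈ i with Any.any? (b ≟ₚ_) (elems G)
      ... | yes b∈′ = sym (_∣ᶻ_.equality (divisible (Y-const b∈′ i i₀)))
      ... | no b∉ = ⊥-elim (b∉ b∈)

      -- Torsion-freeness: after multiplication by `N` the coboundaries of `w` and `W` cancel,
      -- leaving r times `V-cob` up to a constant, and `N` can be cancelled.
      index-cob : PtCob G (λ a b i → r · F a b i) Φ
      index-cob {a} {b} a∈ b∈ i j = ℤₚ.*-cancelʳ-≡ (D′ i) (D′ j) N (begin
        D′ i · N    ≡⟨ D′≡ i ⟩
        r · D i + c ≡⟨ cong (λ d → r · d + c) (V-cob a∈ b∈ i j) ⟩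
        r · D j + c ≡⟨ D′≡ j ⟨
        D′ j · N    ∎)
        where
        open ≡-Reasoning
        D D′ : Fin n → ℤ
        D i = N · F a b i - (V b i - V (a * b) i + V a (b ·ₚ i))
        D′ i = r · F a b i - (Φ b i - Φ (a * b) i + Φ a (b ·ₚ i))
        c : ℤ
        c = Y b i₀ - Y (a * b) i₀ + Y a i₀
        lemma₁ : ∀ r f p q s n → (r · f - (p - q + s)) · n ≡ r · (n · f) - (p · n - q · n + s · n)
        lemma₁ = solve-∀
        lemma₂ : ∀ r f vb vab va wi wb wab Wi Wb Wab y y′ y″ →
          r · f - ((r · (vb - wb + wi) + Wb - Wi - y) - (r · (vab - wab + wi) + Wab - Wi - y′)
            + (r · (va - wab + wb) + Wab - Wb - y″))
          ≡ r · (f - (vb - vab + va)) + (y - y′ + y″)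
        lemma₂ = solve-∀
        D′≡ : ∀ i → D′ i · N ≡ r · D i + c
        D′≡ i = begin
          D′ i · N
            ≡⟨ lemma₁ r (F a b i) (Φ b i) (Φ (a * b) i) (Φ a (b ·ₚ i)) N ⟩
          r · (N · F a b i) - (Φ b i · N - Φ (a * b) i · N + Φ a (b ·ₚ i) · N)
            ≡⟨ cong (λ k → r · (N · F a b i) - k) (cong₂ _+_
                 (cong₂ _-_ (Φ-spec b∈ i) (Φ-spec (mul-closed G a∈ b∈) i)) (Φ-spec a∈ (b ·ₚ i))) ⟩
          r · (N · F a b i) - ((Y b i - Y b i₀) - (Y (a * b) i - Y (a * b) i₀)
            + (Y a (b ·ₚ i) - Y a i₀))
            ≡⟨ cong (λ k → r · (N · F a b i) - ((Y b i - Y b i₀)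
                   - (r · (V (a * b) i - w k + w i) + W k - W i - Y (a * b) i₀)
                   + (Y a (b ·ₚ i) - Y a i₀))) (*-act a b i) ⟩
          _ ≡⟨ lemma₂ r (N · F a b i) (V b i) (V (a * b) i) (V a (b ·ₚ i)) (w i) (w (b ·ₚ i))
                 (w (a ·ₚ (b ·ₚ i))) (W i) (W (b ·ₚ i)) (W (a ·ₚ (b ·ₚ i)))
                 (Y b i₀) (Y (a * b) i₀) (Y a i₀) ⟩
          r · D i + c ∎

-- Orbits of the normal Sylow subgroup

∤⇒coprime : ∀ {p d} → Prime p → ¬ (p ∣ d) → Coprime d p
∤⇒coprime pr p∤d (e∣d , e∣p) with prime⇒irreducible pr e∣p
... | inj₁ e≡1 = e≡1
... | inj₂ refl = ⊥-elim (p∤d e∣d)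

coprime∣^⇒≡1 : ∀ {p d} → Coprime d p → ∀ v → d ∣ p ℕ.^ v → d ≡ 1
coprime∣^⇒≡1 c zero d∣ = ∣1⇒≡1 d∣
coprime∣^⇒≡1 c (suc v) d∣ = coprime∣^⇒≡1 c v (coprime-divisor c d∣)

-- Only d = 1 and d = p remain: after one factor p is removed, the cofactor is prime to p and
-- divides a power of p.
∣^⇒≤ : ∀ {p d} → Prime p → ∀ v → d ∣ p ℕ.^ v → ¬ (p ℕ.^ 2 ∣ d) → d ℕ.≤ p
∣^⇒≤ {p} {d} pr v d∣ p²∤d with p ∣? d
... | no p∤d rewrite coprime∣^⇒≡1 (∤⇒coprime pr p∤d) v d∣ = ℕ.>-nonZero⁻¹ p {{prime⇒nonZero pr}}
... | yes (divides q refl) = ℕₚ.≤-reflexive (trans (cong (ℕ._* p) q≡1) (ℕₚ.*-identityˡ p))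
  where
  p∤q : ¬ (p ∣ q)
  p∤q p∣q = p²∤d (subst (_∣ q ℕ.* p) (cong (p ℕ.*_) (sym (ℕₚ.*-identityʳ p))) (*-monoˡ-∣ p p∣q))
  q≡1 : q ≡ 1
  q≡1 = coprime∣^⇒≡1 (∤⇒coprime pr p∤q) v (∣-trans (m∣m*n p) d∣)

module OrbitSize {n : ℕ} (G S : Subgroup n) (S≤G : S ≤ˢ G) (normal : IsNormal G S)
  (transitive : IsTransitive G) (i : Fin n) where

  module G = SubgroupProperties G
  open SubgroupProperties S

  O : List (Fin n)
  O = filter (orbit? i) (allFin n)

  ∈O : ∀ {j} → Orbit i j → j ∈ O
  ∈O = ∈-filter⁺ (orbit? i) (∈-allFin _)

  O⇒orbit : ∀ {j} → j ∈ O → Orbit i j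
  O⇒orbit j∈ = proj₂ (∈-filter⁻ (orbit? i) {xs = allFin n} j∈)

  O-unique : Unique O
  O-unique = Uniqueₚ.filter⁺ (orbit? i) (Uniqueₚ.allFin⁺ n)

  -- All orbits are translates of O by elements of G.
  |O|∣n : length O ∣ n
  |O|∣n = divides (length R) (sym (trans (ℕₚ.*-comm (length R) (length O)) (trans
    (length-product (λ o r → g r ·ₚ o) O-unique T-distinct (Uniqueₚ.allFin⁺ n)
      (λ _ _ → ∈-allFin _) (λ {x} _ → onto x) inj)
    (length-tabulate id))))
    where
    reps : ∃[ T ] IsTransversal Orbit (allFin n) T
    reps = transversal Orbit orbit? orbit-sym (allFin n) (λ _ → orbit-refl)
    R : List (Fin n)
    R = proj₁ reps
    open IsTransversal (proj₂ reps)
    g : Fin n → Perm n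
    g r = proj₁ (transitive i r)
    g∈ : ∀ r → g r ∈ˢ G
    g∈ r = proj₁ (proj₂ (transitive i r))
    g-act : ∀ r → g r ·ₚ i ≡ r
    g-act r = proj₂ (proj₂ (transitive i r))
    onto : ∀ x → ∃[ o ] ∃[ r ] (o ∈ O × r ∈ R × x ≡ g r ·ₚ o)
    onto x with r , r∈ , r~x ← T-covers (∈-allFin x)
           with s , s∈ , refl ← find r~x
           with s′ , s′∈ , eq ← normal (G.inv∈ (g∈ r)) s∈ =
      g⁻¹ ·ₚ (s ·ₚ r) , r , ∈O (lose s′∈ (sym back)) , r∈ , sym (G.act-inv (g∈ r) _)
      where
      open ≡-Reasoning
      g⁻¹ : Perm n
      g⁻¹ = G.inv (g r)
      back : g⁻¹ ·ₚ (s ·ₚ r) ≡ s′ ·ₚ i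
      back = begin
        g⁻¹ ·ₚ (s ·ₚ r)            ≡⟨ *-act g⁻¹ s r ⟨
        (g⁻¹ * s) ·ₚ r             ≡⟨ cong (_·ₚ r) eq ⟩
        (s′ * g⁻¹) ·ₚ r            ≡⟨ *-act s′ g⁻¹ r ⟩
        s′ ·ₚ (g⁻¹ ·ₚ r)           ≡⟨ cong (λ k → s′ ·ₚ (g⁻¹ ·ₚ k)) (g-act r) ⟨
        s′ ·ₚ (g⁻¹ ·ₚ (g r ·ₚ i))  ≡⟨ cong (s′ ·ₚ_) (G.inv-act (g∈ r) i) ⟩
        s′ ·ₚ i                    ∎
    same-orbit : ∀ {o} r → o ∈ O → Orbit r (g r ·ₚ o)
    same-orbit r o∈ with s , s∈ , refl ← find (O⇒orbit o∈)
                    with s′ , s′∈ , eq ← normal (g∈ r) s∈ =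
      lose s′∈ (begin
        s′ ·ₚ r               ≡⟨ cong (s′ ·ₚ_) (g-act r) ⟨
        s′ ·ₚ (g r ·ₚ i)      ≡⟨ *-act s′ (g r) i ⟨
        (s′ * g r) ·ₚ i       ≡⟨ cong (_·ₚ i) eq ⟨
        (g r * s) ·ₚ i        ≡⟨ *-act (g r) s i ⟩
        g r ·ₚ (s ·ₚ i)       ∎)
      where open ≡-Reasoning
    inj : ∀ {o r o′ r′} → o ∈ O → r ∈ R → o′ ∈ O → r′ ∈ R →
      g r ·ₚ o ≡ g r′ ·ₚ o′ → o ≡ o′ × r ≡ r′
    inj {o} {r} {o′} {r′} o∈ r∈ o′∈ r′∈ eq
      with refl ← T-apart r∈ r′∈ (orbit-trans (subst (Orbit r) eq (same-orbit r o∈))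
                                              (orbit-sym (same-orbit r′ o′∈))) =
      perms G (g∈ r) o o′ eq , refl

  -- Orbit-stabilizer: `c` picks one element carrying i to each point of its orbit, and every s
  -- factors uniquely as such an element times one in the stabilizer list `K`.
  |O|∣|S| : length O ∣ order S
  |O|∣|S| = divides (length K) (sym (length-product (λ k o → c o * k)
    (Uniqueₚ.filter⁺ fix? (unique S)) O-unique (unique S)
    (λ k∈ o∈ → mul-closed S (proj₁ (c-spec (O⇒orbit o∈))) (proj₁ (∈K k∈))) onto inj))
    where
    fix? : ∀ s → Dec (s ·ₚ i ≡ i)
    fix? s = (s ·ₚ i) Finₚ.≟ i
    K : List (Perm n)
    K = filter fix? (elems S)
    ∈K : ∀ {k} → k ∈ K → k ∈ˢ S × k ·ₚ i ≡ i
    ∈K k∈ = ∈-filter⁻ fix? {xs = elems S} k∈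
    c : Fin n → Perm n
    c o with orbit? i o
    ... | yes i~o = proj₁ (find i~o)
    ... | no _ = idP
    c-spec : ∀ {o} → Orbit i o → c o ∈ˢ S × c o ·ₚ i ≡ o
    c-spec {o} i~o with orbit? i o
    ... | yes i~o′ = proj₂ (find i~o′)
    ... | no i≁o = ⊥-elim (i≁o i~o)
    onto : ∀ {s} → s ∈ˢ S → ∃[ k ] ∃[ o ] (k ∈ K × o ∈ O × s ≡ c o * k)
    onto {s} s∈ = inv (c o) * s , o ,
      ∈-filter⁺ fix? (mul-closed S (inv∈ (proj₁ cs)) s∈)
        (trans (*-act (inv (c o)) s i)
          (trans (cong (inv (c o) ·ₚ_) (sym (proj₂ cs))) (inv-act (proj₁ cs) i))) ,
      ∈O i~o , sym (*-inv-cancel (proj₁ cs) s)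
      where
      o : Fin n
      o = s ·ₚ i
      i~o : Orbit i o
      i~o = lose s∈ refl
      cs : c o ∈ˢ S × c o ·ₚ i ≡ o
      cs = c-spec i~o
    image : ∀ {k o} → k ∈ K → o ∈ O → (c o * k) ·ₚ i ≡ o
    image {k} {o} k∈ o∈ = trans (*-act (c o) k i)
      (trans (cong (c o ·ₚ_) (proj₂ (∈K k∈))) (proj₂ (c-spec (O⇒orbit o∈))))
    inj : ∀ {k o k′ o′} → k ∈ K → o ∈ O → k′ ∈ K → o′ ∈ O → c o * k ≡ c o′ * k′ → k ≡ k′ × o ≡ o′
    inj {k} {o} {k′} {o′} k∈ o∈ k′∈ o′∈ eq
      with refl ← trans (sym (image k∈ o∈)) (trans (cong (_·ₚ i) eq) (image k′∈ o′∈)) =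
      *-cancelˡ (proj₁ (c-spec (O⇒orbit o∈))) eq , refl

-- Powers of an element of prime exponent that moves a point

module _ {n : ℕ} {p : ℕ} (pr : Prime p) (e : Perm n) (e-perm : IsPerm e) (e^p : e ^ₚ p ≡ idP)
  {i : Fin n} (moves : ¬ (e ·ₚ i ≡ i)) where

  ^ₚ-perm : ∀ k → IsPerm (e ^ₚ k)
  ^ₚ-perm zero x y eq = trans (sym (idP-act x)) (trans eq (idP-act y))
  ^ₚ-perm (suc k) x y eq = ^ₚ-perm k x y (e-perm _ _
    (trans (sym (*-act e (e ^ₚ k) x)) (trans eq (*-act e (e ^ₚ k) y))))

  ^ₚ-period : ∀ x → e ^ₚ (x ℕ.* p) ≡ idP
  ^ₚ-period x = trans (^ₚ-* e x p) (trans (cong (_^ₚ x) e^p) (idP-^ₚ x))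

  ^ₚ-multiple-fix : ∀ {d} → (e ^ₚ d) ·ₚ i ≡ i → ∀ y → (e ^ₚ (y ℕ.* d)) ·ₚ i ≡ i
  ^ₚ-multiple-fix {d} fix y = trans (cong (_·ₚ i) (^ₚ-* e y d)) (^ₚ-fix (e ^ₚ d) fix y)

  -- If the d-th power fixed i, so would e itself, because d and p are coprime and the p-th power is
  -- trivial. The two cases are the signs in Bézout's identity.
  ^ₚ-moves : ∀ {d} → .{{ℕ.NonZero d}} → d ℕ.< p → ¬ ((e ^ₚ d) ·ₚ i ≡ i)
  ^ₚ-moves {d} d<p fix with coprime-Bézout (prime⇒coprime pr d<p)
  ... | Bézout.+- x y eq = moves (begin
    e ·ₚ i                          ≡⟨ cong (e ·ₚ_) (^ₚ-multiple-fix fix y) ⟨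
    e ·ₚ ((e ^ₚ (y ℕ.* d)) ·ₚ i)    ≡⟨ *-act e (e ^ₚ (y ℕ.* d)) i ⟨
    (e ^ₚ (1 ℕ.+ y ℕ.* d)) ·ₚ i     ≡⟨ cong (λ k → (e ^ₚ k) ·ₚ i) eq ⟩
    (e ^ₚ (x ℕ.* p)) ·ₚ i           ≡⟨ cong (_·ₚ i) (^ₚ-period x) ⟩
    idP ·ₚ i                        ≡⟨ idP-act i ⟩
    i                               ∎)
    where open ≡-Reasoning
  ... | Bézout.-+ x y eq = moves (begin
    e ·ₚ i                          ≡⟨ cong (e ·ₚ_) (idP-act i) ⟨
    e ·ₚ (idP ·ₚ i)                 ≡⟨ cong (λ a → e ·ₚ (a ·ₚ i)) (^ₚ-period x) ⟨
    e ·ₚ ((e ^ₚ (x ℕ.* p)) ·ₚ i)    ≡⟨ *-act e (e ^ₚ (x ℕ.* p)) i ⟨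
    (e ^ₚ (1 ℕ.+ x ℕ.* p)) ·ₚ i     ≡⟨ cong (λ k → (e ^ₚ k) ·ₚ i) eq ⟩
    (e ^ₚ (y ℕ.* d)) ·ₚ i           ≡⟨ ^ₚ-multiple-fix fix y ⟩
    i                               ∎)
    where open ≡-Reasoning

  ^ₚ-distinct : ∀ {k l} → k ℕ.< l → l ℕ.< p → ¬ ((e ^ₚ k) ·ₚ i ≡ (e ^ₚ l) ·ₚ i)
  ^ₚ-distinct {k} {l} k<l l<p eq = ^ₚ-moves {l ℕ.∸ k} {{ℕ.>-nonZero (ℕₚ.m<n⇒0<n∸m k<l)}}
    (ℕₚ.≤-<-trans (ℕₚ.m∸n≤m l k) l<p)
    (^ₚ-perm k _ _ (begin
      (e ^ₚ k) ·ₚ ((e ^ₚ (l ℕ.∸ k)) ·ₚ i)  ≡⟨ *-act (e ^ₚ k) (e ^ₚ (l ℕ.∸ k)) i ⟨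
      ((e ^ₚ k) * (e ^ₚ (l ℕ.∸ k))) ·ₚ i   ≡⟨ cong (_·ₚ i) (^ₚ-+ e k (l ℕ.∸ k)) ⟨
      (e ^ₚ (k ℕ.+ (l ℕ.∸ k))) ·ₚ i        ≡⟨ cong (λ m → (e ^ₚ m) ·ₚ i) (ℕₚ.m+[n∸m]≡n (ℕₚ.<⇒≤ k<l)) ⟩
      (e ^ₚ l) ·ₚ i                        ≡⟨ eq ⟨
      (e ^ₚ k) ·ₚ i                        ∎))
    where open ≡-Reasoning

  powers : List (Fin n)
  powers = map (λ k → (e ^ₚ k) ·ₚ i) (upTo p)

  powers-unique : Unique powers
  powers-unique = map-unique (λ k → (e ^ₚ k) ·ₚ i) inj (Uniqueₚ.upTo⁺ p)
    where
    inj : ∀ {k l} → k ∈ upTo p → l ∈ upTo p → (e ^ₚ k) ·ₚ i ≡ (e ^ₚ l) ·ₚ i → k ≡ l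
    inj {k} {l} k∈ l∈ eq with ℕₚ.<-cmp k l
    ... | tri< k<l _ _ = ⊥-elim (^ₚ-distinct k<l (∈-upTo⁻ l∈) eq)
    ... | tri≈ _ k≡l _ = k≡l
    ... | tri> _ _ l<k = ⊥-elim (^ₚ-distinct l<k (∈-upTo⁻ k∈) (sym eq))

-- Orbits of prime length and points in general position

module CyclicOrbits {n p : ℕ} (pr : Prime p) (p²∤n : ¬ (p ℕ.^ 2 ∣ n)) (G S : Subgroup n)
  (S≤G : S ≤ˢ G) (normal : IsNormal G S) (transitive : IsTransitive G)
  {v : ℕ} (|S| : order S ≡ p ℕ.^ v) (exponent : ∀ {e} → e ∈ˢ S → e ^ₚ p ≡ idP) where

  open SubgroupProperties S

  -- The orbit of i has at most p elements, and the powers of e produce p of them.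
  cyclic-orbit : ∀ {e b i} → e ∈ˢ S → b ∈ˢ S → ¬ (e ·ₚ i ≡ i) → ∃[ k ] (b ·ₚ i ≡ (e ^ₚ k) ·ₚ i)
  cyclic-orbit {e} {b} {i} e∈ b∈ moves with Any.any? ((b ·ₚ i) Finₚ.≟_) L
    where
    L : List (Fin n)
    L = powers pr e (perms S e∈) (exponent e∈) moves
  ... | yes bi∈ = let (k , _ , eq) = ∈-map⁻ (λ k → (e ^ₚ k) ·ₚ i) bi∈ in k , eq
  ... | no bi∉ = ⊥-elim (ℕₚ.1+n≰n (ℕₚ.≤-trans
      (subst (ℕ._≤ length O) (cong suc (trans (length-map _ (upTo p)) (length-upTo p)))
        (unique-⊆⇒length≤ (All.tabulate (λ { x∈ refl → bi∉ x∈ }) ∷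
          powers-unique pr e (perms S e∈) (exponent e∈) moves) O ⊆O))
      (∣^⇒≤ pr v (subst (length O ∣_) |S| |O|∣|S|) (λ p²∣ → p²∤n (∣-trans p²∣ |O|∣n)))))
    where
    open OrbitSize G S S≤G normal transitive i
    ⊆O : ∀ {x} → x ∈ (b ·ₚ i) ∷ powers pr e (perms S e∈) (exponent e∈) moves → x ∈ O
    ⊆O (here refl) = ∈O (lose b∈ refl)
    ⊆O (there x∈) with k , _ , refl ← ∈-map⁻ (λ k → (e ^ₚ k) ·ₚ i) x∈ = ∈O (lose (^ₚ-closed e∈ k) refl)

  -- The elimination step: with e as pivot at i, a power of e clears the effect of b on i.
  adjust : ∀ {e b i} → e ∈ˢ S → b ∈ˢ S → ¬ (e ·ₚ i ≡ i) → ∃[ k ] ((b * (e ^ₚ k)) ·ₚ i ≡ i)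
  adjust {e} {b} {i} e∈ b∈ moves with k , eq ← cyclic-orbit e∈ (inv∈ b∈) moves =
    k , trans (*-act b (e ^ₚ k) i) (trans (cong (b ·ₚ_) (sym eq)) (act-inv b∈ i))

  moved-point : ∀ {a : Perm n} → ¬ (a ≡ idP) → ∃[ i ] ¬ (a ·ₚ i ≡ i)
  moved-point {a} a≢1 with Finₚ.any? (λ i → ¬? ((a ·ₚ i) Finₚ.≟ i))
  ... | yes found = found
  ... | no none = ⊥-elim (a≢1 (perm-ext λ i → trans
    (decidable-stable ((a ·ₚ i) Finₚ.≟ i) (λ m → none (i , m))) (sym (idP-act i))))

  *-moves : ∀ (a b : Perm n) {i} → ¬ (a ·ₚ i ≡ i) → b ·ₚ i ≡ i → ¬ ((a * b) ·ₚ i ≡ i)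
  *-moves a b {i} ma fb fab = ma (trans (cong (a ·ₚ_) (sym fb)) (trans (sym (*-act a b i)) fab))

  -- The powers of e₁ are transitive on the orbit of i₁ and fix the other two points; likewise for
  -- e₃ and i₃. These powers supply `move₁` and `move₃`.
  record ThreePoints : Set where
    field
      i₁ i₂ i₃ : Fin n
      e₁ e₃ : Perm n
      e₁∈        : e₁ ∈ˢ S
      e₁-moves₁  : ¬ (e₁ ·ₚ i₁ ≡ i₁)
      e₁-fix₂    : e₁ ·ₚ i₂ ≡ i₂
      e₁-fix₃    : e₁ ·ₚ i₃ ≡ i₃
      e₃∈        : e₃ ∈ˢ S
      e₃-fix₁    : e₃ ·ₚ i₁ ≡ i₁
      e₃-fix₂    : e₃ ·ₚ i₂ ≡ i₂
      e₃-moves₃  : ¬ (e₃ ·ₚ i₃ ≡ i₃)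

  -- Gaussian elimination on three independent elements.
  three-points : ∀ {a₁ a₂ a₃} → a₁ ∈ˢ S → a₂ ∈ˢ S → a₃ ∈ˢ S → ¬ (a₁ ≡ idP) →
    (∀ k → ¬ (a₂ * (a₁ ^ₚ k) ≡ idP)) →
    (∀ k l m → ¬ ((a₃ * (a₁ ^ₚ k)) * ((a₂ * (a₁ ^ₚ l)) ^ₚ m) ≡ idP)) →
    ThreePoints
  three-points {a₁} {a₂} {a₃} a₁∈ a₂∈ a₃∈ a₁≢1 a₂-indep a₃-indep
    -- Forward elimination with pivots a₁ at i₃, b₂ at i₁ and e₂ at i₂. Independence ensures that
    -- each cleared element is nontrivial and so moves a point.
    with i₃ , a₁-moves₃ ← moved-point a₁≢1
    with k , b₂-fix₃ ← adjust a₁∈ a₂∈ a₁-moves₃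
    with l , b₃-fix₃ ← adjust a₁∈ a₃∈ a₁-moves₃
    with i₁ , b₂-moves₁ ← moved-point (a₂-indep k)
    with m , e₂-fix₁ ← adjust {a₂ * (a₁ ^ₚ k)} {a₃ * (a₁ ^ₚ l)}
           (mul-closed S a₂∈ (^ₚ-closed a₁∈ k)) (mul-closed S a₃∈ (^ₚ-closed a₁∈ l)) b₂-moves₁
    with i₂ , e₂-moves₂ ← moved-point (a₃-indep l k m) =
    elimination
    where
    b₂ b₃ e₂ : Perm n
    b₂ = a₂ * (a₁ ^ₚ k)
    b₃ = a₃ * (a₁ ^ₚ l)
    e₂ = b₃ * (b₂ ^ₚ m)
    b₂∈ : b₂ ∈ˢ S
    b₂∈ = mul-closed S a₂∈ (^ₚ-closed a₁∈ k)
    e₂∈ : e₂ ∈ˢ S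
    e₂∈ = mul-closed S (mul-closed S a₃∈ (^ₚ-closed a₁∈ l)) (^ₚ-closed b₂∈ m)
    e₂-fix₃ : e₂ ·ₚ i₃ ≡ i₃
    e₂-fix₃ = *-fix b₃ (b₂ ^ₚ m) b₃-fix₃ (^ₚ-fix b₂ b₂-fix₃ m)
    elimination : ThreePoints
    elimination
      -- Back substitution: e₂ clears i₂ from b₂ and a₁, and afterwards e₁ clears i₁ from the
      -- result. Each pivot fixes the points already settled.
      with q , e₁-fix₂ ← adjust e₂∈ b₂∈ e₂-moves₂
      with s , c-fix₂ ← adjust e₂∈ a₁∈ e₂-moves₂ = finish
      where
      e₁ c : Perm n
      e₁ = b₂ * (e₂ ^ₚ q)
      c = a₁ * (e₂ ^ₚ s)
      e₁∈ : e₁ ∈ˢ S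
      e₁∈ = mul-closed S b₂∈ (^ₚ-closed e₂∈ q)
      c∈ : c ∈ˢ S
      c∈ = mul-closed S a₁∈ (^ₚ-closed e₂∈ s)
      e₁-fix₃ : e₁ ·ₚ i₃ ≡ i₃
      e₁-fix₃ = *-fix b₂ (e₂ ^ₚ q) b₂-fix₃ (^ₚ-fix e₂ e₂-fix₃ q)
      e₁-moves₁ : ¬ (e₁ ·ₚ i₁ ≡ i₁)
      e₁-moves₁ = *-moves b₂ (e₂ ^ₚ q) b₂-moves₁ (^ₚ-fix e₂ e₂-fix₁ q)
      finish : ThreePoints
      finish with t , e₃-fix₁ ← adjust e₁∈ c∈ e₁-moves₁ = record
        { i₁ = i₁ ; i₂ = i₂ ; i₃ = i₃ ; e₁ = e₁ ; e₃ = c * (e₁ ^ₚ t)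
        ; e₁∈ = e₁∈ ; e₁-fix₂ = e₁-fix₂ ; e₁-fix₃ = e₁-fix₃ ; e₁-moves₁ = e₁-moves₁
        ; e₃∈ = mul-closed S c∈ (^ₚ-closed e₁∈ t)
        ; e₃-fix₁ = e₃-fix₁
        ; e₃-fix₂ = *-fix c (e₁ ^ₚ t) c-fix₂ (^ₚ-fix e₁ e₁-fix₂ t)
        ; e₃-moves₃ = *-moves c (e₁ ^ₚ t)
            (*-moves a₁ (e₂ ^ₚ s) a₁-moves₃ (^ₚ-fix e₂ e₂-fix₃ s)) (^ₚ-fix e₁ e₁-fix₃ t)
        }

-- Elementary abelian groups

module Elementary {n p : ℕ} (pr : Prime p) {m : ℕ} (S : Subgroup n) (iso : IsoToCpPower p pr m S) where

  open SubgroupProperties S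

  instance
    p≢0 : ℕ.NonZero p
    p≢0 = prime⇒nonZero pr

  infixl 6 _⊞_
  _⊞_ : Vec (Fin p) m → Vec (Fin p) m → Vec (Fin p) m
  _⊞_ = _+ᶜ_ p

  ι : Vec (Fin p) m → Perm n
  ι = proj₁ iso

  ι∈ : ∀ u → ι u ∈ˢ S
  ι∈ = proj₁ (proj₂ iso)

  ι-onto : ∀ {s} → s ∈ˢ S → ∃[ u ] (ι u ≡ s)
  ι-onto = proj₁ (proj₂ (proj₂ iso))

  ι-inj : ∀ u v → ι u ≡ ι v → u ≡ v
  ι-inj = proj₁ (proj₂ (proj₂ (proj₂ iso)))

  ι-hom : ∀ u v → ι (u ⊞ v) ≡ ι u * ι v
  ι-hom = proj₂ (proj₂ (proj₂ (proj₂ iso)))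

  O I : Fin p
  O = 0 mod p
  I = 1 mod p

  toℕ-mod : ∀ k → toℕ (k mod p) ≡ k % p
  toℕ-mod k = Finₚ.toℕ-fromℕ< (m%n<n k p)

  mod-cong : ∀ {k l} → k % p ≡ l % p → k mod p ≡ l mod p
  mod-cong {k} {l} eq = Finₚ.toℕ-injective (trans (toℕ-mod k) (trans eq (sym (toℕ-mod l))))

  toℕ-O : toℕ O ≡ 0
  toℕ-O = trans (toℕ-mod 0) (m*n%n≡0 0 p)

  1<p : 1 ℕ.< p
  1<p = ℕ.nonTrivial⇒n>1 p {{prime⇒nonTrivial pr}}

  toℕ-I : toℕ I ≡ 1
  toℕ-I = trans (toℕ-mod 1) (m<n⇒m%n≡m 1<p)

  mod-toℕ : ∀ (a : Fin p) → toℕ a mod p ≡ a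
  mod-toℕ a = Finₚ.toℕ-injective (trans (toℕ-mod (toℕ a)) (m<n⇒m%n≡m (Finₚ.toℕ<n a)))

  +O : ∀ (a : Fin p) → (toℕ a ℕ.+ toℕ O) mod p ≡ a
  +O a = trans (cong (_mod p) (trans (cong (toℕ a ℕ.+_) toℕ-O) (ℕₚ.+-identityʳ _))) (mod-toℕ a)

  mod-+ʳ : ∀ k l → (k ℕ.+ toℕ (l mod p)) mod p ≡ (k ℕ.+ l) mod p
  mod-+ʳ k l = mod-cong (begin
    (k ℕ.+ toℕ (l mod p)) % p       ≡⟨ cong (λ x → (k ℕ.+ x) % p) (toℕ-mod l) ⟩
    (k ℕ.+ l % p) % p               ≡⟨ %-distribˡ-+ k (l % p) p ⟩
    (k % p ℕ.+ l % p % p) % p       ≡⟨ cong (λ x → (k % p ℕ.+ x) % p) (m%n%n≡m%n l p) ⟩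
    (k % p ℕ.+ l % p) % p           ≡⟨ %-distribˡ-+ k l p ⟨
    (k ℕ.+ l) % p                   ∎)
    where open ≡-Reasoning

  ⊞-comm : ∀ {l} (u v : Vec (Fin p) l) → _+ᶜ_ p u v ≡ _+ᶜ_ p v u
  ⊞-comm [] [] = refl
  ⊞-comm (a ∷ u) (b ∷ v) = cong₂ _∷_ (cong (_mod p) (ℕₚ.+-comm (toℕ a) (toℕ b))) (⊞-comm u v)

  commutative : ∀ {a b} → a ∈ˢ S → b ∈ˢ S → a * b ≡ b * a
  commutative a∈ b∈ with u , refl ← ι-onto a∈ with v , refl ← ι-onto b∈ =
    trans (sym (ι-hom u v)) (trans (cong ι (⊞-comm u v)) (ι-hom v u))

  smul : ∀ {l} → ℕ → Vec (Fin p) l → Vec (Fin p) l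
  smul k = Vec.map (λ a → (k ℕ.* toℕ a) mod p)

  smul-suc : ∀ {l} k (u : Vec (Fin p) l) → smul (suc k) u ≡ _+ᶜ_ p u (smul k u)
  smul-suc k [] = refl
  smul-suc k (a ∷ u) = cong₂ _∷_ (sym (mod-+ʳ (toℕ a) (k ℕ.* toℕ a))) (smul-suc k u)

  smul-p : ∀ {l} (u : Vec (Fin p) l) → smul p u ≡ replicate l O
  smul-p [] = refl
  smul-p (a ∷ u) = cong₂ _∷_ (mod-cong (trans (cong (_% p) (ℕₚ.*-comm p (toℕ a))) (trans (m*n%n≡0 (toℕ a) p) (sym (m*n%n≡0 0 p))))) (smul-p u)

  O⊞O : ∀ l → _+ᶜ_ p (replicate l O) (replicate l O) ≡ replicate l O
  O⊞O zero = refl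
  O⊞O (suc l) = cong₂ _∷_ (+O O) (O⊞O l)

  ι-O : ι (replicate m O) ≡ idP
  ι-O = *-cancelˡ (ι∈ _) (trans (sym (ι-hom _ _)) (trans (cong ι (O⊞O m)) (sym (*-identityʳ _))))

  ι-^ : ∀ k u → ι (smul k u) ≡ ι u ^ₚ k
  ι-^ zero u = trans (cong ι (map-const u O)) ι-O
  ι-^ (suc k) u = trans (cong ι (smul-suc k u)) (trans (ι-hom u (smul k u)) (cong (ι u *_) (ι-^ k u)))

  exponent : ∀ {e} → e ∈ˢ S → e ^ₚ p ≡ idP
  exponent e∈ with u , refl ← ι-onto e∈ = trans (sym (ι-^ p u)) (trans (cong ι (smul-p u)) ι-O)

  -- Additive coordinates on S through `ι`, used to certify independence: an element with some
  -- coordinate 1 is not the identity.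
  Coord : Fin m → Fin p → Perm n → Set
  Coord j c s = ∃[ u ] (ι u ≡ s × lookup u j ≡ c)

  coord-* : ∀ {j c s t} → Coord j c s → Coord j O t → Coord j c (s * t)
  coord-* {j} (u , refl , refl) (v , refl , vj) = u ⊞ v , ι-hom u v ,
    trans (lookup-zipWith _ j u v) (trans (cong (λ b → (toℕ (lookup u j) ℕ.+ toℕ b) mod p) vj)
      (+O (lookup u j)))

  coord-^ : ∀ {j t} → Coord j O t → ∀ k → Coord j O (t ^ₚ k)
  coord-^ {j} ct zero = replicate m O , ι-O , lookup-replicate j O
  coord-^ ct (suc k) = coord-* ct (coord-^ ct k)

  coord-I : ∀ {j s} → Coord j I s → ¬ (s ≡ idP)
  coord-I {j} (u , refl , uj) eq = ℕₚ.1+n≢0 (begin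
    1                ≡⟨ toℕ-I ⟨
    toℕ I            ≡⟨ cong toℕ uj ⟨
    toℕ (lookup u j) ≡⟨ cong (λ v → toℕ (lookup v j)) (ι-inj u _ (trans eq (sym ι-O))) ⟩
    toℕ (lookup (replicate m O) j) ≡⟨ cong toℕ (lookup-replicate j O) ⟩
    toℕ O            ≡⟨ toℕ-O ⟩
    0                ∎)
    where open ≡-Reasoning

-- Local conditions

∈⇒length≢0 : {A : Set} {x : A} {xs : List A} → x ∈ xs → ℕ.NonZero (length xs)
∈⇒length≢0 (here _) = _
∈⇒length≢0 (there _) = _

module Local {n : ℕ} (G K : Subgroup n) (K≤G : K ≤ˢ G) (N : ℤ)
  (F : Perm n → Perm n → Fin n → ℤ) (V Φ : Perm n → Fin n → ℤ)
  (V-cob : PtCob G (λ a b i → N · F a b i) V) (Φ-cob : PtCob K F Φ) where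

  open SubgroupProperties K

  -- On K both `V` and N Φ have coboundary N F, so their difference is a crossed homomorphism modulo
  -- constants over ℤ, not merely modulo `N`.
  D : Perm n → Fin n → ℤ
  D a i = V a i - N · Φ a i

  D-cocycle : ∀ {a b} → a ∈ˢ K → b ∈ˢ K → ∀ i j →
    D (a * b) i - D a (b ·ₚ i) - D b i ≡ D (a * b) j - D a (b ·ₚ j) - D b j
  D-cocycle {a} {b} a∈ b∈ i j = begin
    D (a * b) i - D a (b ·ₚ i) - D b i ≡⟨ split i ⟩
    P i - N · Q i ≡⟨ cong₂ (λ x y → x - N · y) (V-cob (K≤G a∈) (K≤G b∈) i j) (Φ-cob a∈ b∈ i j) ⟩
    P j - N · Q j ≡⟨ split j ⟨
    D (a * b) j - D a (b ·ₚ j) - D b j ∎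
    where
    open ≡-Reasoning
    P Q : Fin n → ℤ
    P i = N · F a b i - (V b i - V (a * b) i + V a (b ·ₚ i))
    Q i = F a b i - (Φ b i - Φ (a * b) i + Φ a (b ·ₚ i))
    lemma : ∀ n f vb vab va pb pab pa →
      (vab - n · pab) - (va - n · pa) - (vb - n · pb)
      ≡ (n · f - (vb - vab + va)) - n · (f - (pb - pab + pa))
    lemma = solve-∀
    split : ∀ i → D (a * b) i - D a (b ·ₚ i) - D b i ≡ P i - N · Q i
    split i = lemma N (F a b i) (V b i) (V (a * b) i) (V a (b ·ₚ i)) (Φ b i) (Φ (a * b) i) (Φ a (b ·ₚ i))

  -- At points fixed by a, the difference of the values of `D` grows by δ with each further power of
  -- a. Periodicity gives p δ = 0, so δ = 0 in ℤ and V a i - V a j is `N` times a difference of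
  -- values of Φ a.
  fixed-points-agree : ∀ {a p} .{{_ : ℕ.NonZero p}} → a ∈ˢ K → a ^ₚ p ≡ idP →
    ∀ {i j} → a ·ₚ i ≡ i → a ·ₚ j ≡ j → Congruence._≈_ N (V a i) (V a j)
  fixed-points-agree {a} {p} a∈ a^p {i} {j} fi fj = mk≈ (dividesᶻ (Φ a i - Φ a j) (begin
    V a i - V a j ≡⟨ lemma₁ N (V a i) (V a j) (Φ a i) (Φ a j) ⟩
    δ + (Φ a i - Φ a j) · N ≡⟨ cong (_+ (Φ a i - Φ a j) · N) δ≡0 ⟩
    0ℤ + (Φ a i - Φ a j) · N ≡⟨ ℤₚ.+-identityˡ _ ⟩
    (Φ a i - Φ a j) · N ∎))
    where
    open Congruence N
    open ≡-Reasoning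
    lemma₁ : ∀ n v v′ p p′ → v - v′ ≡ ((v - n · p) - (v′ - n · p′)) + (p - p′) · n
    lemma₁ = solve-∀
    δ : ℤ
    δ = D a i - D a j
    Δ : ℕ → ℤ
    Δ k = D (a ^ₚ k) i - D (a ^ₚ k) j
    Δ-step : ∀ k → Δ (suc k) ≡ δ + Δ k
    Δ-step k = begin
      Δ (suc k)
        ≡⟨ lemma₂ (D (a ^ₚ suc k) i) (D a i) (D (a ^ₚ k) i) (D (a ^ₚ suc k) j) (D a j) (D (a ^ₚ k) j) ⟩
      (D (a ^ₚ suc k) i - D a i - D (a ^ₚ k) i) - (D (a ^ₚ suc k) j - D a j - D (a ^ₚ k) j) + (δ + Δ k)
        ≡⟨ cong₂ (λ x y → (D (a ^ₚ suc k) i - D a x - D (a ^ₚ k) i)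
                   - (D (a ^ₚ suc k) j - D a y - D (a ^ₚ k) j) + (δ + Δ k))
             (sym (^ₚ-fix a fi k)) (sym (^ₚ-fix a fj k)) ⟩
      C i - C j + (δ + Δ k)
        ≡⟨ cong (λ c → c - C j + (δ + Δ k)) (D-cocycle a∈ (^ₚ-closed a∈ k) i j) ⟩
      C j - C j + (δ + Δ k)
        ≡⟨ cong (_+ (δ + Δ k)) (ℤₚ.+-inverseʳ (C j)) ⟩
      0ℤ + (δ + Δ k) ≡⟨ ℤₚ.+-identityˡ _ ⟩
      δ + Δ k ∎
      where
      C : Fin n → ℤ
      C i = D (a ^ₚ suc k) i - D a ((a ^ₚ k) ·ₚ i) - D (a ^ₚ k) i
      lemma₂ : ∀ x y z x′ y′ z′ →
        x - x′ ≡ (x - y - z) - (x′ - y′ - z′) + ((y - y′) + (z - z′))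
      lemma₂ = solve-∀
    Δ-multiple : ∀ k → Δ k ≡ ℤ.+ k · δ + Δ 0
    Δ-multiple zero = sym (ℤₚ.+-identityˡ (Δ 0))
    Δ-multiple (suc k) = trans (Δ-step k) (trans (cong (δ +_) (Δ-multiple k)) (lemma₃ (ℤ.+ k) δ (Δ 0)))
      where
      lemma₃ : ∀ k d z → d + (k · d + z) ≡ (ℤ.1ℤ + k) · d + z
      lemma₃ = solve-∀
    pδ≡0 : ℤ.+ p · δ ≡ 0ℤ
    pδ≡0 = begin
      ℤ.+ p · δ                 ≡⟨ lemma₄ (ℤ.+ p · δ) (Δ 0) ⟩
      (ℤ.+ p · δ + Δ 0) - Δ 0   ≡⟨ cong (_- Δ 0) (Δ-multiple p) ⟨
      Δ p - Δ 0                 ≡⟨ cong (λ b → D b i - D b j - Δ 0) a^p ⟩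
      Δ 0 - Δ 0                 ≡⟨ ℤₚ.+-inverseʳ (Δ 0) ⟩
      0ℤ                        ∎
      where
      lemma₄ : ∀ x y → x ≡ (x + y) - y
      lemma₄ = solve-∀
    δ≡0 : δ ≡ 0ℤ
    δ≡0 with ℤₚ.i*j≡0⇒i≡0∨j≡0 (ℤ.+ p) pδ≡0
    ... | inj₁ p≡0 = ⊥-elim (ℕ.≢-nonZero⁻¹ p (ℤₚ.+-injective p≡0))
    ... | inj₂ d≡0 = d≡0

  W : Fin n → ℤ
  W i = ∑ (elems K) λ a → D a i

  -- The order of K kills the class of `D` in H¹(K, J), and averaging over K exhibits this.
  -- Replacing `D` by V - N Φ explains the factor `M` on both `V` and the modulus.
  averaged-split : let M = ℤ.+ order K ; w = λ i → - W i in
    ∀ {b} → b ∈ˢ K → ∀ i j → Congruence._≈_ (M · N)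
      (M · V b i - w (b ·ₚ i) + w i) (M · V b j - w (b ·ₚ j) + w j)
  averaged-split {b} b∈ i j = mk≈ (dividesᶻ (Φ b i - Φ b j) (begin
    A i - A j
      ≡⟨ lemma₁ M N (V b i) (V b j) (Φ b i) (Φ b j) (W i) (W j) (W (b ·ₚ i)) (W (b ·ₚ j)) ⟩
    (q j - q i) + (Φ b i - Φ b j) · (M · N)
      ≡⟨ cong (λ x → (q j - x) + (Φ b i - Φ b j) · (M · N)) q-const ⟩
    (q j - q j) + (Φ b i - Φ b j) · (M · N)
      ≡⟨ cong (_+ (Φ b i - Φ b j) · (M · N)) (ℤₚ.+-inverseʳ (q j)) ⟩
    0ℤ + (Φ b i - Φ b j) · (M · N)
      ≡⟨ ℤₚ.+-identityˡ _ ⟩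
    (Φ b i - Φ b j) · (M · N) ∎))
    where
    open Congruence (ℤ.+ order K · N)
    open ≡-Reasoning
    M : ℤ
    M = ℤ.+ order K
    A q : Fin n → ℤ
    A i = M · V b i - - W (b ·ₚ i) + - W i
    q i = W i - W (b ·ₚ i) - M · D b i
    lemma₁ : ∀ m n v v′ f f′ w w′ x x′ →
      (m · v - - x + - w) - (m · v′ - - x′ + - w′)
      ≡ ((w′ - x′ - m · (v′ - n · f′)) - (w - x - m · (v - n · f))) + (f - f′) · (m · n)
    lemma₁ = solve-∀
    total : ∀ i → ∑ (elems K) (λ a → D (a * b) i - D a (b ·ₚ i) - D b i) ≡ q i
    total i = trans (∑-distrib-- _ _ (elems K)) (cong₂ _-_
      (trans (∑-distrib-- _ _ (elems K)) (cong (_- W (b ·ₚ i))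
        (trans (sym (∑-map (_* b) (λ a → D a i) (elems K)))
          (∑-↭ (λ a → D a i) (right-translate-↭ b∈)))))
      (∑-const (D b i) (elems K)))
    q-const : q i ≡ q j
    q-const = trans (sym (total i))
      (trans (∑-cong (elems K) (λ a∈ → D-cocycle a∈ b∈ i j)) (total j))

bézout-ℤ : ∀ {m n} → Coprime m n → ∃[ x ] ∃[ y ] (x · ℤ.+ m + y · ℤ.+ n ≡ ℤ.1ℤ)
bézout-ℤ {m} {n} c with coprime-Bézout c
... | Bézout.+- x y eq = ℤ.+ x , - (ℤ.+ y) ,
  trans (cong (_+ - (ℤ.+ y) · ℤ.+ n) (trans (sym (ℤₚ.pos-* x m))
    (trans (cong ℤ.+_ (sym eq)) (cong (ℤ.1ℤ +_) (ℤₚ.pos-* y n))))) (lemma (ℤ.+ y) (ℤ.+ n))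
  where
  lemma : ∀ y n → ℤ.1ℤ + y · n + - y · n ≡ ℤ.1ℤ
  lemma = solve-∀
... | Bézout.-+ x y eq = - (ℤ.+ x) , ℤ.+ y ,
  trans (cong (- (ℤ.+ x) · ℤ.+ m +_) (trans (sym (ℤₚ.pos-* y n))
    (trans (cong ℤ.+_ (sym eq)) (cong (ℤ.1ℤ +_) (ℤₚ.pos-* x m))))) (lemma (ℤ.+ x) (ℤ.+ m))
  where
  lemma : ∀ x m → - x · m + (ℤ.1ℤ + x · m) ≡ ℤ.1ℤ
  lemma = solve-∀

-- Combination of splitting, transfer and torsion

module Assembly {p : ℕ} (pr : Prime p) {n : ℕ} (p²∤n : ¬ (p ^ 2 ∣ n))
  (G H : Subgroup n) (transitive : IsTransitive G)
  (i₀ : Fin n) (stab : IsPointStabilizer G H i₀)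
  (S : Subgroup n) (sylow : IsSylow p G S) (normal : IsNormal G S)
  (𝒟 : List (Subgroup n)) (admissible : IsAdmissible G 𝒟)
  (f : Cochain2 n) (f-cocycle : Is2Cocycle G H f)
  (local : ∀ {D} → D ∈ 𝒟 → IsCoboundaryOn G H D f)
  (torsion : ∃[ k ] IsCoboundaryOn G H G (scale2 (p ^ k) f)) where

  open Points G H transitive i₀ stab

  S≤G : S ≤ˢ G
  S≤G = proj₁ sylow

  F : Perm n → Perm n → Fin n → ℤ
  F = pt₂ f

  N : ℤ
  N = ℤ.+ order G

  instance
    |G|≢0 : ℕ.NonZero (order G)
    |G|≢0 = ∈⇒length≢0 (has-id G)

    |S|≢0 : ℕ.NonZero (order S)
    |S|≢0 = ∈⇒length≢0 (has-id S)

  abstract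
    averaged : ∃[ V ] PtCob G (λ a b i → N · F a b i) V
    averaged = toPtCob G (scale2 (order G) f) id (order-kills f-cocycle)

  V : Perm n → Fin n → ℤ
  V = proj₁ averaged

  V-cob : PtCob G (λ a b i → N · F a b i) V
  V-cob = proj₂ averaged

  open Cosets G S S≤G using (T; order-*-index; module Transfer)

  index-prime-to-p : ¬ (p ∣ length T)
  index-prime-to-p with v , r , _ , |G| , p∤r ← proj₂ sylow =
    subst (λ t → ¬ (p ∣ t)) (sym (ℕₚ.*-cancelˡ-≡ (length T) r (order S) (trans order-*-index |G|))) p∤r

  -- The modulus and the cochain stay free because the cyclic case applies this to |S| |G| and |S|
  -- V, the case of three points to |G| and `V`. Bézout applies as the index of S is prime to p.
  conclude : (M : ℤ) .{{_ : ℤ.NonZero M}} (U : Perm n → Fin n → ℤ) →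
    PtCob G (λ a b i → M · F a b i) U → (w : Fin n → ℤ) →
    (∀ {a} → a ∈ˢ S → ∀ i j → Congruence._≈_ M
      (U a i - w (a ·ₚ i) + w i) (U a j - w (a ·ₚ j) + w j)) →
    IsCoboundaryOn G H G f
  conclude M U U-cob w split = fromPtCob f (proj₁ f-cocycle)
    (PtCob-combine G F (Transfer.Φ M i₀ F U U-cob w split) (proj₁ Ψ) (proj₁ bézout) (ℤ.+ length T) (proj₁ (proj₂ bézout)) (ℤ.+ (p ^ k))
      (proj₂ (proj₂ bézout)) (Transfer.index-cob M i₀ F U U-cob w split) (proj₂ Ψ))
    where
    k : ℕ
    k = proj₁ torsion
    Ψ : ∃[ Ψ ] PtCob G (λ a b i → ℤ.+ (p ^ k) · F a b i) Ψ
    Ψ = toPtCob G (scale2 (p ^ k) f) id (proj₂ torsion)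
    bézout : ∃[ x ] ∃[ y ] (x · ℤ.+ length T + y · ℤ.+ (p ^ k) ≡ ℤ.1ℤ)
    bézout = bézout-ℤ (λ (d∣T , d∣p^k) →
      coprime∣^⇒≡1 (∤⇒coprime pr (λ p∣d → index-prime-to-p (∣-trans p∣d d∣T))) k d∣p^k)

  -- The admissible set contains the group generated by g, which contains S, so f is a coboundary on
  -- S itself.
  cyclic-case : ∀ {g} → g ∈ˢ S → (∀ {s} → s ∈ˢ S → ∃[ k ] (s ≡ g ^ₚ k)) → IsCoboundaryOn G H G f
  cyclic-case g∈ generates
    with D , D∈ , D-gen ← find (proj₁ (proj₂ admissible) (S≤G g∈))
    with φ , φ-ind , φ-cob ← local D∈
    with Φ , Φ-cob ← toPtCob S f S≤G
      (φ , (λ a∈ → φ-ind (Equivalence.from (D-gen _) (generates a∈))) ,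
       (λ a∈ b∈ → φ-cob (Equivalence.from (D-gen _) (generates a∈)) (Equivalence.from (D-gen _) (generates b∈)))) =
    conclude (M · N) {{ℤ.≢-nonZero MN≢0}} (λ a i → M · V a i) scaled (λ i → - W i) averaged-split
    where
    open Local G S S≤G N F V Φ V-cob Φ-cob
    M : ℤ
    M = ℤ.+ order S
    MN≢0 : ¬ (M · N ≡ 0ℤ)
    MN≢0 eq with ℤₚ.i*j≡0⇒i≡0∨j≡0 M eq
    ... | inj₁ M≡0 = ℕ.≢-nonZero⁻¹ (order S) (ℤₚ.+-injective M≡0)
    ... | inj₂ N≡0 = ℕ.≢-nonZero⁻¹ (order G) (ℤₚ.+-injective N≡0)
    lemma : ∀ m n f p q r → m · n · f - (m · p - m · q + m · r) ≡ m · (n · f - (p - q + r))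
    lemma = solve-∀
    scaled : PtCob G (λ a b i → M · N · F a b i) (λ a i → M · V a i)
    scaled {a} {b} a∈ b∈ i j = trans
      (lemma M N (F a b i) (V b i) (V (a * b) i) (V a (b ·ₚ i)))
      (trans (cong (M ·_) (V-cob a∈ b∈ i j))
        (sym (lemma M N (F a b j) (V b j) (V (a * b) j) (V a (b ·ₚ j)))))

  module _ {m : ℕ} (iso : IsoToCpPower p pr m S) where

    open Elementary pr S iso
    open SubgroupProperties S

    V-compat : ∀ {a} → a ∈ˢ S → ∀ {i j} → a ·ₚ i ≡ i → a ·ₚ j ≡ j → Congruence._≈_ N (V a i) (V a j)
    V-compat {a} a∈
      with D , D∈ , D-gen ← find (proj₁ (proj₂ admissible) (S≤G a∈))
      with Φ , Φ-cob ← toPtCob D f (proj₁ admissible D∈) (local D∈) =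
      Local.fixed-points-agree G D (proj₁ admissible D∈) N F V Φ V-cob Φ-cob
        (Equivalence.from (D-gen a) (1 , sym (*-identityʳ a))) (exponent a∈)

    V-cocycle : ∀ {a b} → a ∈ˢ S → b ∈ˢ S → ∀ i j → Congruence._≈_ N
      (V (a * b) i - V a (b ·ₚ i) - V b i) (V (a * b) j - V a (b ·ₚ j) - V b j)
    V-cocycle {a} {b} a∈ b∈ i j = Congruence.mk≈ (dividesᶻ (F a b j - F a b i)
      (trans (lemma N (F a b i) (F a b j) (V (a * b) i) (V a (b ·ₚ i)) (V b i)
                (V (a * b) j) (V a (b ·ₚ j)) (V b j))
        (trans (cong (λ x → x - (N · F a b j - (V b j - V (a * b) j + V a (b ·ₚ j)))
                   + (F a b j - F a b i) · N) (V-cob (S≤G a∈) (S≤G b∈) i j))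
          (trans (cong (_+ (F a b j - F a b i) · N)
              (ℤₚ.+-inverseʳ (N · F a b j - (V b j - V (a * b) j + V a (b ·ₚ j)))))
            (ℤₚ.+-identityˡ _)))))
      where
      lemma : ∀ n f f′ x y z x′ y′ z′ → (x - y - z) - (x′ - y′ - z′)
        ≡ (n · f - (z - x + y)) - (n · f′ - (z′ - x′ + y′)) + (f′ - f) · n
      lemma = solve-∀

    open CyclicOrbits pr p²∤n G S S≤G normal transitive {proj₁ (proj₂ sylow)}
      (proj₁ (proj₂ (proj₂ (proj₂ sylow)))) exponent

    three-points-case : ThreePoints → IsCoboundaryOn G H G f
    three-points-case t = conclude N V V-cob (proj₁ split) (proj₂ split)
      where
      open ThreePoints t
      split : ∃[ w ] (∀ {a} → a ∈ˢ S → ∀ i j → Congruence._≈_ N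
        (V a i - w (a ·ₚ i) + w i) (V a j - w (a ·ₚ j) + w j))
      split = AbelianSplitting.splitting N S commutative V V-cocycle V-compat cyclic-orbit i₁ i₂ i₃
        (λ a∈ → let (k , eq) = cyclic-orbit e₃∈ a∈ e₃-moves₃ in
          e₃ ^ₚ k , ^ₚ-closed e₃∈ k , ^ₚ-fix e₃ e₃-fix₁ k , ^ₚ-fix e₃ e₃-fix₂ k , eq)
        (λ a∈ → let (k , eq) = cyclic-orbit e₁∈ a∈ e₁-moves₁ in
          e₁ ^ₚ k , ^ₚ-closed e₁∈ k , ^ₚ-fix e₁ e₁-fix₂ k , ^ₚ-fix e₁ e₁-fix₃ k , eq)

    independent-case : ∀ {a₁ a₂ a₃} → a₁ ∈ˢ S → a₂ ∈ˢ S → a₃ ∈ˢ S → ¬ (a₁ ≡ idP) →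
      (∀ k → ¬ (a₂ * (a₁ ^ₚ k) ≡ idP)) →
      (∀ k l m → ¬ ((a₃ * (a₁ ^ₚ k)) * ((a₂ * (a₁ ^ₚ l)) ^ₚ m) ≡ idP)) →
      IsCoboundaryOn G H G f
    independent-case a₁∈ a₂∈ a₃∈ h₁ h₂ h₃ = three-points-case (three-points a₁∈ a₂∈ a₃∈ h₁ h₂ h₃)

  rank-cases : ∀ m → m ≢ 2 → IsoToCpPower p pr m S → IsCoboundaryOn G H G f
  rank-cases 0 _ iso = cyclic-case (has-id S) λ s∈ → 0 , trivial s∈
    where
    open Elementary pr S iso
    trivial : ∀ {s} → s ∈ˢ S → s ≡ idP
    trivial s∈ with [] , refl ← ι-onto s∈ = ι-O
  rank-cases 1 _ iso = cyclic-case (ι∈ (I ∷ [])) generates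
    where
    open Elementary pr S iso
    generates : ∀ {s} → s ∈ˢ S → ∃[ k ] (s ≡ ι (I ∷ []) ^ₚ k)
    generates s∈ with a ∷ [] , refl ← ι-onto s∈ = toℕ a , trans
      (cong (λ b → ι (b ∷ [])) (sym (trans
        (cong (_mod p) (trans (cong (toℕ a ℕ.*_) toℕ-I) (ℕₚ.*-identityʳ (toℕ a)))) (mod-toℕ a))))
      (ι-^ (toℕ a) (I ∷ []))
  rank-cases 2 m≢2 _ = ⊥-elim (m≢2 refl)
  rank-cases (suc (suc (suc m))) _ iso = independent-case iso (ι∈ u₁) (ι∈ u₂) (ι∈ u₃)
    -- Each product has coordinate 1 in the direction of its newest basis vector, to which the
    -- earlier factors contribute 0.
    (coord-I {fzero} (u₁ , refl , refl))
    (λ k → coord-I {j₂} (coord-* (u₂ , refl , refl) (coord-^ (u₁ , refl , refl) k)))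
    (λ k l q → coord-I {j₃} (coord-* (coord-* (u₃ , refl , refl) (coord-^ (u₁ , refl , refl) k))
      (coord-^ (coord-* (u₂ , refl , refl) (coord-^ (u₁ , refl , refl) l)) q)))
    where
    open Elementary pr S iso
    j₂ j₃ : Fin (3 ℕ.+ m)
    j₂ = fsuc fzero
    j₃ = fsuc (fsuc fzero)
    u₁ u₂ u₃ : Vec (Fin p) (3 ℕ.+ m)
    u₁ = I ∷ O ∷ O ∷ replicate m O
    u₂ = O ∷ I ∷ O ∷ replicate m O
    u₃ = O ∷ O ∷ I ∷ replicate m O

theorem6p10 : (p : ℕ) (pr : Prime p) (n : ℕ) →
    p ∣ n → ¬ (p ^ 2 ∣ n) →
    (G H : Subgroup n) → IsTransitive G →
    (i₀ : Fin n) → IsPointStabilizer G H i₀ →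
    (S : Subgroup n) → IsSylow p G S → IsNormal G S →
    (m : ℕ) → m ≢ 2 → IsoToCpPower p pr m S →
    (𝒟 : List (Subgroup n)) → IsAdmissible G 𝒟 →
    (f : Cochain2 n) → Is2Cocycle G H f →
    (∀ {D} → D ∈ 𝒟 → IsCoboundaryOn G H D f) →
    (∃[ k ] IsCoboundaryOn G H G (scale2 (p ^ k) f)) →
    IsCoboundaryOn G H G f
theorem6p10 p pr n _ p²∤n G H transitive i₀ stab S sylow normal m m≢2 iso 𝒟 admissible
  f f-cocycle local torsion =
  Assembly.rank-cases pr p²∤n G H transitive i₀ stab S sylow normal 𝒟 admissible
    f f-cocycle local torsion m m≢2 iso
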